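{- Let $n\geq 1$ and let ${\cal E}_n:=\mathrm{conv}\{e(G): G \text{ a simple graph on vertex set } [n]\}\subset\mathbb{R}^n$ be the degree enumerator polytope of the complete graph $K_n$. The vertices of ${\cal E}_n$ are as follows. \begin{itemize} \item If $n$ is even, they are $e_n(r):=n\cdot{\bf 1}_r=e(G_n(r))$ for $0\leq r\leq n-1$. \item If $n$ is odd, they are: (1) $e_n(r)=n\cdot{\bf 1}_r=e(G_n(r))$ for even $0\leq r\leq n-1$; and (2) $e_n(r,s):=(n-1)\cdot{\bf 1}_r+{\bf 1}_s=e(G_n(r,s))$ for odd $0<r<n-1$ and even $0\leq s\leq n-1$. \end{itemize} The number of vertices is $n$ for even $n$ and $\left(\frac{n+1}{2}\right)^2$ for odd $n$.
   Context: Notation: $[n]:=\{0,1,\dots,n-1\}$. Vectors in $\mathbb{R}^n$ are indexed $x=(x_0,\dots,x_{n-1})$, and ${\bf 1}_i$ ($i=0,\dots,n-1$) denotes the $i$-th unit vector. For a simple graph $G$ on vertex set $[n]$, $d_v(G)$ is the degree of vertex $v$, and the degree enumerator of $G$ is $e(G)=(e_0(G),\dots,e_{n-1}(G))$ where $e_i(G)$ is the number of vertices of $G$ of degree $i$. The graphs $G_n(r)$ and $G_n(r,s)$ on vertex set $[n]$: For any $n\geq1$ and even $0\leq r\leq n-1$, $G_n(r)$ has edge set $E_n(r):=\{\{i,(i+j)\bmod n\}: i=0,\dots,n-1,\ j=1,\dots,r/2\}$ (each vertex on a circle joined to the $r/2$ nearest vertices on each side); it is $r$-regular. For even $n$ and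 odd $1\leq r\leq n-1$, $E_n(r):=E_n(r-1)\uplus M_n$ where $M_n:=\{\{i,n/2+i\}: i=0,\dots,n/2-1\}$ is a perfect matching; $G_n(r)$ is $r$-regular. For odd $n$, odd $0<r<n-1$ and even $0\leq s\leq n-1$, $G_n(r,s)$ has edge set $E_n(r,s):=E_{n-1}(r)$ if $s=0$, and if $s\geq2$, $E_n(r,s):=\big(E_{n-1}(r)\setminus\{\{i,\tfrac{n-1}{2}+i\}: i=0,\dots,\tfrac s2-1\}\big)\uplus\{\{i,n-1\}: i=0,\dots,\tfrac s2-1\}\uplus\{\{\tfrac{n-1}{2}+i,n-1\}: i=0,\dots,\tfrac s2-1\}$; so vertex $n-1$ has degree $s$ and all other vertices have degree $r$.
   Formalization: The polytope is taken in rational n-space: it is the set of rational convex combinations of the degree enumerators e(G), and its vertices are the extreme points among rational points, rather than in real n-space. -}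

module Defs where

open import Data.Bool.Base using (Bool; true; false; if_then_else_; not; _∨_; _∧_)
open import Data.Nat.Base using (ℕ; zero; suc; _+_; _∸_; _≡ᵇ_; ⌊_/2⌋)
open import Data.Nat.DivMod using (_%_)
open import Data.Fin.Base using (Fin; toℕ)
open import Data.List.Base using (List; []; _∷_; map; concatMap; upTo; filterᵇ; _++_; foldr)
open import Data.Bool.ListAction using (any)
open import Data.List.Relation.Unary.All using (All)
open import Data.Product using (Σ; _×_; _,_; proj₁; proj₂)
open import Data.Integer.Base using (+_)
open import Data.Rational.Base using (ℚ; 0ℚ; 1ℚ; _≤_; _<_) renaming (_+_ to _+ℚ_; _*_ to _*ℚ_; _-_ to _-ℚ_; _/_ to _/ℚ_)
open import Relation.Binary.PropositionalEquality using (_≡_)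

Adj : ℕ → Set
Adj n = Fin n → Fin n → Bool

record SimpleGraph (n : ℕ) : Set where
  field
    adj    : Adj n
    sym    : ∀ u v → adj u v ≡ adj v u
    irrefl : ∀ v → adj v v ≡ false
open SimpleGraph public

count : ∀ {n} → (Fin n → Bool) → ℕ
count {zero}  p = 0
count {suc n} p = (if p Fin.zero then 1 else 0) + count (λ i → p (Fin.suc i))
  where import Data.Fin.Base as Fin

deg : ∀ {n} → Adj n → Fin n → ℕ
deg A v = count (λ w → A v w)

degEnum : ∀ {n} → Adj n → Fin n → ℕ
degEnum A i = count (λ v → deg A v ≡ᵇ toℕ i)

Point : ℕ → Set
Point n = Fin n → ℚ

_≈_ : ∀ {n} → Point n → Point n → Set
x ≈ y = ∀ i → x i ≡ y i

toℚ : ℕ → ℚ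
toℚ k = (+ k) /ℚ 1

embed : ∀ {n} → (Fin n → ℕ) → Point n
embed v i = toℚ (v i)

_≈ℕ_ : ∀ {n} → (Fin n → ℕ) → (Fin n → ℕ) → Set
x ≈ℕ y = ∀ i → x i ≡ y i

scaledUnit : (n c r : ℕ) → Fin n → ℕ
scaledUnit n c r i = if toℕ i ≡ᵇ r then c else 0

eR : (n r : ℕ) → Fin n → ℕ
eR n r = scaledUnit n n r

eRS : (n r s : ℕ) → Fin n → ℕ
eRS n r s i = scaledUnit n (n ∸ 1) r i + scaledUnit n 1 s i

-- The degree enumerator polytope E_n = conv{ e(G) : G simple graph on [n] }
-- (rational convex combinations; finitely many generators, all integral).

weightedSum : ∀ {n} → List (ℚ × SimpleGraph n) → Point n
weightedSum L i = foldr (λ p acc → (proj₁ p *ℚ embed (degEnum (adj (proj₂ p))) i) +ℚ acc) 0ℚ L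

InE : (n : ℕ) → Point n → Set
InE n x = Σ (List (ℚ × SimpleGraph n)) λ L →
            All (λ p → 0ℚ ≤ proj₁ p) L
          × foldr (λ p acc → proj₁ p +ℚ acc) 0ℚ L ≡ 1ℚ
          × x ≈ weightedSum L

IsVertex : (n : ℕ) → Point n → Set
IsVertex n x = InE n x
  × (∀ (y z : Point n) (t : ℚ) → InE n y → InE n z → 0ℚ < t → t < 1ℚ
       → (∀ i → x i ≡ (t *ℚ y i) +ℚ ((1ℚ -ℚ t) *ℚ z i)) → y ≈ z)

HasVertexCount : (n N : ℕ) → Set
HasVertexCount n N = Σ (Fin N → Point n) λ f →
    (∀ k → IsVertex n (f k))
  × (∀ k l → f k ≈ f l → k ≡ l)
  × (∀ x → IsVertex n x → Σ (Fin N) λ k → f k ≈ x)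

Edge : Set
Edge = ℕ × ℕ

sameEdge : Edge → Edge → Bool
sameEdge (a , b) (u , v) = ((a ≡ᵇ u) ∧ (b ≡ᵇ v)) ∨ ((a ≡ᵇ v) ∧ (b ≡ᵇ u))

adjOf : ∀ {n} → List Edge → Adj n
adjOf E u v = any (λ e → sameEdge e (toℕ u , toℕ v)) E

circEdges : ℕ → ℕ → List Edge
circEdges zero    r = []
circEdges (suc m) r = concatMap (λ i → map (λ j → (i , (i + suc j) % suc m)) (upTo ⌊ r /2⌋)) (upTo (suc m))

matching : ℕ → List Edge
matching n = map (λ i → (i , ⌊ n /2⌋ + i)) (upTo ⌊ n /2⌋)

isEven : ℕ → Bool
isEven r = r % 2 ≡ᵇ 0

edgesR : ℕ → ℕ → List Edge
edgesR n r = if isEven r then circEdges n r else circEdges n (r ∸ 1) ++ matching n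

-- E_n(r,s) (n odd, r odd, s even); for s = 0 this is E_{n-1}(r)
edgesRS : ℕ → ℕ → ℕ → List Edge
edgesRS n r s =
     filterᵇ (λ e → not (any (sameEdge e) removed)) (edgesR (n ∸ 1) r)
  ++ map (λ i → (i , n ∸ 1)) (upTo ⌊ s /2⌋)
  ++ map (λ i → (⌊ (n ∸ 1) /2⌋ + i , n ∸ 1)) (upTo ⌊ s /2⌋)
  where
    removed : List Edge
    removed = map (λ i → (i , ⌊ (n ∸ 1) /2⌋ + i)) (upTo ⌊ s /2⌋)

G : (n r : ℕ) → Adj n
G n r = adjOf (edgesR n r)

GRS : (n r s : ℕ) → Adj n
GRS n r s = adjOf (edgesRS n r s)

module Submission where

-- Every listed point is exposed by a functional x ↦ Σ c_i x_i with natural coefficients,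
-- whose value at e(H) is the total cost Σ_v c(d_v) of the degrees of H: c is 0 at r and 1 elsewhere for n 1_r, and
-- 0 at r, 1 at s and at the other odd degrees, 2 at the other even degrees for (n-1) 1_r + 1_s. In the latter case the
-- minimum is 1, because by the handshake lemma a graph with an odd number of vertices has a vertex of even degree.
-- Conversely, an extreme point equals every point of any average that represents it. So it is some e(H), and
-- e(H) is the mean of n 1_{d_v} over all v if n is even, and the mean of (n-1) 1_{d_v} + 1_{d_u} over v ≠ u, for a
-- vertex u of even degree, if n is odd; for odd d_v this is a point of the list, and for even d_v it is the mean of
-- n-1 copies of n 1_{d_v} and one copy of n 1_{d_u}.

open import Defs hiding (sym)
import Data.Fin.Base as Fin
open import Data.Fin.Base using (Fin; toℕ; fromℕ; fromℕ<; punchIn; remQuot; combine)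
open import Data.List.Base using (List; []; _∷_; [_]; map; foldr; length; upTo; concat; _++_; filterᵇ; tabulate; allFin)
open import Data.List.Relation.Unary.All as All using (All; []; _∷_)
import Data.List.Relation.Unary.All.Properties as All using (map⁺)
open import Data.Product using (_×_; _,_; proj₁; proj₂; ∃-syntax; uncurry)
import Data.Sum as Sum
open import Data.Sum using (_⊎_; inj₁; inj₂; [_,_]′)
open import Function.Base using (_∘_; id)
open import Relation.Binary.PropositionalEquality hiding ([_])
open import Relation.Nullary using (¬_; Dec; yes; no; does; contradiction)

-- Vertices of convex hulls of degree enumerators

-- Both directions need the circulant graphs themselves: they attain the minima of the functionals,
-- and their enumerators are the terms of the averages. Computing their degrees is the laborious
-- point. Each neighbourhood is therefore given as a duplicate-free list of numbers u + a modulo n,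
-- with a in a list of offsets independent of u; regularity is then the length of that list, and the
-- bound on r keeps the offsets distinct. In G_n(r,s) a vertex other than the hub deviates from this
-- in at most one list entry. The averages carry natural multiplicities, so that their identities
-- live in `ℕ` and the division by the number of graphs is confined to one lemma.

module Convexity where

  open import Algebra.Bundles using (CommutativeRing)
  import Algebra.Properties.Semiring.Sum as Summation
  import Data.Integer.Base as ℤ
  import Data.Integer.Properties as ℤ
  open import Data.Nat.Base as ℕ using (ℕ; zero; suc)
  import Data.Nat.Properties as ℕ
  open import Data.Rational.Base
  open import Data.Rational.Properties
  open import Data.Rational.Solver using (module +-*-Solver)
  open import Data.Rational.Unnormalised.Base using (mkℚᵘ; *≡*; *≤*)
    renaming (_≃_ to _≃ᵘ_; _+_ to _+ᵘ_; _*_ to _*ᵘ_)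
  import Data.Rational.Unnormalised.Properties as ℚᵘ
  module ∑ = Summation ℕ.+-*-semiring
  module ∑ℚ = Summation (CommutativeRing.semiring +-*-commutativeRing)
  open +-*-Solver using (solve; _:=_; _:+_; _:*_; _:-_; con)

  -- `toℚ` normalises by a gcd, which is stuck on a variable. The unnormalised representative with
  -- denominator 1 is not, so additivity, multiplicativity and order reduce to integer arithmetic.
  toℚᵘ-toℚ : ∀ k → toℚᵘ (toℚ k) ≃ᵘ mkℚᵘ (ℤ.+ k) 0
  toℚᵘ-toℚ k = toℚᵘ-fromℚᵘ (mkℚᵘ (ℤ.+ k) 0)

  toℚ-+ : ∀ a b → toℚ (a ℕ.+ b) ≡ toℚ a + toℚ b
  toℚ-+ a b = toℚᵘ-injective (begin
    toℚᵘ (toℚ (a ℕ.+ b))                      ≈⟨ toℚᵘ-toℚ (a ℕ.+ b) ⟩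
    mkℚᵘ (ℤ.+ (a ℕ.+ b)) 0                    ≈⟨ *≡* (cong (ℤ._* ℤ.1ℤ) (sym (cong₂ ℤ._+_ (ℤ.*-identityʳ (ℤ.+ a)) (ℤ.*-identityʳ (ℤ.+ b))))) ⟩
    mkℚᵘ (ℤ.+ a) 0 +ᵘ mkℚᵘ (ℤ.+ b) 0          ≈⟨ ℚᵘ.+-cong (toℚᵘ-toℚ a) (toℚᵘ-toℚ b) ⟨
    toℚᵘ (toℚ a) +ᵘ toℚᵘ (toℚ b)              ≈⟨ toℚᵘ-homo-+ (toℚ a) (toℚ b) ⟨
    toℚᵘ (toℚ a + toℚ b)                      ∎)
    where open ℚᵘ.≃-Reasoning

  toℚ-* : ∀ a b → toℚ (a ℕ.* b) ≡ toℚ a * toℚ b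
  toℚ-* a b = toℚᵘ-injective (begin
    toℚᵘ (toℚ (a ℕ.* b))                      ≈⟨ toℚᵘ-toℚ (a ℕ.* b) ⟩
    mkℚᵘ (ℤ.+ (a ℕ.* b)) 0                    ≈⟨ *≡* (cong (ℤ._* ℤ.1ℤ) (ℤ.pos-* a b)) ⟩
    mkℚᵘ (ℤ.+ a) 0 *ᵘ mkℚᵘ (ℤ.+ b) 0          ≈⟨ ℚᵘ.*-cong (toℚᵘ-toℚ a) (toℚᵘ-toℚ b) ⟨
    toℚᵘ (toℚ a) *ᵘ toℚᵘ (toℚ b)              ≈⟨ toℚᵘ-homo-* (toℚ a) (toℚ b) ⟨
    toℚᵘ (toℚ a * toℚ b)                      ∎)
    where open ℚᵘ.≃-Reasoning

  toℚ-mono-≤ : ∀ {a b} → a ℕ.≤ b → toℚ a ≤ toℚ b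
  toℚ-mono-≤ {a} {b} a≤b = toℚᵘ-cancel-≤ (ℚᵘ.≤-respˡ-≃ (ℚᵘ.≃-sym (toℚᵘ-toℚ a)) (ℚᵘ.≤-respʳ-≃ (ℚᵘ.≃-sym (toℚᵘ-toℚ b))
    (*≤* (ℤ.*-monoʳ-≤-nonNeg ℤ.1ℤ (ℤ.+≤+ a≤b)))))

  toℚ-cancel-≤ : ∀ {a b} → toℚ a ≤ toℚ b → a ℕ.≤ b
  toℚ-cancel-≤ {a} {b} le with ℚᵘ.≤-respˡ-≃ (toℚᵘ-toℚ a) (ℚᵘ.≤-respʳ-≃ (toℚᵘ-toℚ b) (toℚᵘ-mono-≤ le))
  ... | *≤* le′ = ℤ.drop‿+≤+ (ℤ.*-cancelʳ-≤-pos (ℤ.+ a) (ℤ.+ b) ℤ.1ℤ le′)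

  toℚ-injective : ∀ {a b} → toℚ a ≡ toℚ b → a ≡ b
  toℚ-injective eq = ℕ.≤-antisym (toℚ-cancel-≤ (≤-reflexive eq)) (toℚ-cancel-≤ (≤-reflexive (sym eq)))

  embed-injective : ∀ {n} {e e′ : Fin n → ℕ} → embed e ≈ embed e′ → e ≈ℕ e′
  embed-injective eq i = toℚ-injective (eq i)

  toℚ-sum : ∀ {n} (f : Fin n → ℕ) → toℚ (∑.sum f) ≡ ∑ℚ.sum (toℚ ∘ f)
  toℚ-sum {zero} f = refl
  toℚ-sum {suc n} f = trans (toℚ-+ (f Fin.zero) _) (cong (toℚ (f Fin.zero) +_) (toℚ-sum (f ∘ Fin.suc)))

  *-nonNeg : ∀ {p q} → 0ℚ ≤ p → 0ℚ ≤ q → 0ℚ ≤ p * q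
  *-nonNeg {p} {q} 0≤p 0≤q = subst (_≤ p * q) (*-zeroʳ p) (*-monoˡ-≤-nonNeg p {{nonNegative 0≤p}} 0≤q)

  ≤∧≢⇒< : ∀ {p q} → p ≤ q → p ≢ q → p < q
  ≤∧≢⇒< p≤q p≢q = ≰⇒> λ q≤p → p≢q (≤-antisym p≤q q≤p)

  -- Strictness in one summand would make the sums strict. In this way tightness of a total passes
  -- down to its parts, for weights as well as for values of a functional.
  +-tight : ∀ {a a′ b b′} → a ≤ a′ → b ≤ b′ → a′ + b′ ≤ a + b → a′ ≤ a × b′ ≤ b
  +-tight a≤a′ b≤b′ le =
    ≮⇒≥ (λ a<a′ → <-irrefl refl (<-≤-trans (+-mono-<-≤ a<a′ b≤b′) le)) ,
    ≮⇒≥ (λ b<b′ → <-irrefl refl (<-≤-trans (+-mono-≤-< a≤a′ b<b′) le))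

  module _ {n : ℕ} where

    Weighting : Set
    Weighting = List (ℚ × SimpleGraph n)

    total : Weighting → ℚ
    total = foldr (λ p acc → proj₁ p + acc) 0ℚ

    NonNegWeights : Weighting → Set
    NonNegWeights = All (λ p → 0ℚ ≤ proj₁ p)

    enum : SimpleGraph n → Fin n → ℕ
    enum G = degEnum (adj G)

    scale : ℚ → Weighting → Weighting
    scale s = map (λ p → s * proj₁ p , proj₂ p)

    total-nonNeg : ∀ {L} → NonNegWeights L → 0ℚ ≤ total L
    total-nonNeg [] = ≤-refl
    total-nonNeg (p ∷ ps) = +-mono-≤ p (total-nonNeg ps)

    total-scale : ∀ s L → total (scale s L) ≡ s * total L
    total-scale s [] = sym (*-zeroʳ s)
    total-scale s ((w , G) ∷ L) = trans (cong (s * w +_) (total-scale s L)) (sym (*-distribˡ-+ s w (total L)))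

    weightedSum-scale : ∀ s L i → weightedSum (scale s L) i ≡ s * weightedSum L i
    weightedSum-scale s [] i = sym (*-zeroʳ s)
    weightedSum-scale s ((w , G) ∷ L) i = trans (cong₂ _+_ (*-assoc s w _) (weightedSum-scale s L i))
      (sym (*-distribˡ-+ s (w * _) (weightedSum L i)))

    scale-nonNeg : ∀ {s L} → 0ℚ ≤ s → NonNegWeights L → NonNegWeights (scale s L)
    scale-nonNeg 0≤s ps = All.map⁺ (All.map (*-nonNeg 0≤s) ps)

    weightless : ∀ {L} → NonNegWeights L → total L ≡ 0ℚ → ∀ i → weightedSum L i ≡ 0ℚ
    weightless [] _ i = refl
    weightless {(w , G) ∷ L} (p ∷ ps) eq i = begin
      w * toℚ (enum G i) + weightedSum L i  ≡⟨ cong₂ (λ a b → a * toℚ (enum G i) + b) w≡0 (weightless ps L≡0 i) ⟩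
      0ℚ * toℚ (enum G i) + 0ℚ              ≡⟨ +-identityʳ (0ℚ * toℚ (enum G i)) ⟩
      0ℚ * toℚ (enum G i)                   ≡⟨ *-zeroˡ (toℚ (enum G i)) ⟩
      0ℚ                                    ∎
      where
      open ≡-Reasoning
      tight = +-tight p (total-nonNeg ps) (≤-reflexive eq)
      w≡0 = ≤-antisym (proj₁ tight) p
      L≡0 = ≤-antisym (proj₂ tight) (total-nonNeg ps)

    graph∈E : ∀ G → InE n (embed (enum G))
    graph∈E G = ((1ℚ , G) ∷ []) , (nonNegative⁻¹ 1ℚ ∷ []) , +-identityʳ 1ℚ ,
      λ i → sym (trans (+-identityʳ _) (*-identityˡ _))

    soleHead≈ : ∀ {w G L} → NonNegWeights L → w + total L ≡ 1ℚ → total L ≡ 0ℚ → weightedSum ((w , G) ∷ L) ≈ embed (enum G)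
    soleHead≈ {w} {G} {L} nn sum≡1 W≡0 i = begin
      w * toℚ (enum G i) + weightedSum L i  ≡⟨ cong₂ (λ a b → a * toℚ (enum G i) + b) w≡1 (weightless nn W≡0 i) ⟩
      1ℚ * toℚ (enum G i) + 0ℚ              ≡⟨ +-identityʳ (1ℚ * toℚ (enum G i)) ⟩
      1ℚ * toℚ (enum G i)                   ≡⟨ *-identityˡ (toℚ (enum G i)) ⟩
      toℚ (enum G i)                        ∎
      where
      open ≡-Reasoning
      w≡1 : w ≡ 1ℚ
      w≡1 = trans (sym (+-identityʳ w)) (trans (cong (w +_) (sym W≡0)) sum≡1)

    -- Since the other graphs carry weight, x lies strictly between e(G) and their normalised
    -- average z; extremality identifies these two points, and x with both.
    vertex≈properHead : ∀ {x w G L} → IsVertex n x → 0ℚ < w → NonNegWeights L → w + total L ≡ 1ℚ → 0ℚ < total L →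
                        x ≈ weightedSum ((w , G) ∷ L) → x ≈ embed (enum G)
    vertex≈properHead {x} {w} {G} {L} (_ , extreme) 0<w nn sum≡1 0<W x≈ i = begin
        x i                                                   ≡⟨ x≡ i ⟩
        w * toℚ (enum G i) + (1ℚ - w) * z i                   ≡⟨ cong (λ a → w * toℚ (enum G i) + (1ℚ - w) * a) (G≈z i) ⟨
        w * toℚ (enum G i) + (1ℚ - w) * toℚ (enum G i)        ≡⟨ solve 2 (λ w e → w :* e :+ (con 1ℚ :- w) :* e := e) refl w (toℚ (enum G i)) ⟩
        toℚ (enum G i)                                        ∎
      where
      open ≡-Reasoning
      W = total L
      instance
        W-pos : Positive W
        W-pos = positive 0<W
        W-nonZero : NonZero W
        W-nonZero = pos⇒nonZero W
      s = 1/ W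
      1-w≡W : 1ℚ - w ≡ W
      1-w≡W = trans (cong (_- w) (sym sum≡1)) (solve 2 (λ w W → w :+ W :- w := W) refl w W)
      -- The remaining weights sum to W = 1 - w; dividing them by W makes them a convex combination.
      z : Point n
      z = weightedSum (scale s L)
      z∈E : InE n z
      z∈E = scale s L , scale-nonNeg (<⇒≤ (positive⁻¹ s {{1/pos⇒pos W}})) nn ,
            trans (total-scale s L) (*-inverseˡ W) , λ _ → refl
      w<1 : w < 1ℚ
      w<1 = subst₂ _<_ (+-identityʳ w) sum≡1 (+-monoʳ-< w 0<W)
      x≡ : ∀ i → x i ≡ w * toℚ (enum G i) + (1ℚ - w) * z i
      x≡ i = trans (x≈ i) (cong (w * toℚ (enum G i) +_) (begin
        weightedSum L i              ≡⟨ *-identityˡ _ ⟨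
        1ℚ * weightedSum L i         ≡⟨ cong (_* weightedSum L i) (*-inverseʳ W) ⟨
        W * s * weightedSum L i      ≡⟨ *-assoc W s _ ⟩
        W * (s * weightedSum L i)    ≡⟨ cong₂ _*_ 1-w≡W (weightedSum-scale s L i) ⟨
        (1ℚ - w) * z i               ∎))
      G≈z : embed (enum G) ≈ z
      G≈z = extreme _ _ w (graph∈E G) z∈E 0<w w<1 x≡

    vertex≈head : ∀ {x w G L} → IsVertex n x → 0ℚ < w → NonNegWeights L → w + total L ≡ 1ℚ →
                  x ≈ weightedSum ((w , G) ∷ L) → x ≈ embed (enum G)
    vertex≈head {x} {w} {G} {L} vx 0<w nn sum≡1 x≈ = split (total L ≟ 0ℚ)
      where
      split : Dec (total L ≡ 0ℚ) → x ≈ embed (enum G)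
      split (yes W≡0) i = trans (x≈ i) (soleHead≈ {w} {G} {L} nn sum≡1 W≡0 i)
      split (no W≢0) = vertex≈properHead {x} {w} {G} {L} vx 0<w nn sum≡1 (≤∧≢⇒< (total-nonNeg nn) (W≢0 ∘ sym)) x≈

    vertex≈graph : ∀ {x} → IsVertex n x → ∃[ G ] (x ≈ embed (enum G))
    vertex≈graph {x} vx@((L , nn , sum≡1 , x≈) , _) = go L nn sum≡1 x≈
      where
      go : ∀ L → NonNegWeights L → total L ≡ 1ℚ → x ≈ weightedSum L → ∃[ G ] (x ≈ embed (enum G))
      -- The empty list needs no clause, its total being `0ℚ` and not `1ℚ`. Leading graphs of weight
      -- zero are dropped until one of positive weight appears.
      go ((w , G) ∷ L) (p ∷ ps) sum≡1 x≈ = split (w ≟ 0ℚ)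
        where
        split : Dec (w ≡ 0ℚ) → ∃[ G ] (x ≈ embed (enum G))
        split (no w≢0) = G , vertex≈head {x} {w} {G} {L} vx (≤∧≢⇒< p (w≢0 ∘ sym)) ps sum≡1 x≈
        split (yes w≡0) = go L ps (trans (sym (trans (cong (_+ total L) w≡0) (+-identityˡ (total L)))) sum≡1)
          λ i → trans (x≈ i) (trans (cong (λ a → a * toℚ (enum G i) + weightedSum L i) w≡0)
            (trans (cong (_+ weightedSum L i) (*-zeroˡ (toℚ (enum G i)))) (+-identityˡ (weightedSum L i))))

    -- Averages with natural multiplicities.

    multiplicity : List (ℕ × SimpleGraph n) → ℕ
    multiplicity = foldr (λ p acc → proj₁ p ℕ.+ acc) 0

    enumSum : List (ℕ × SimpleGraph n) → Fin n → ℕ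
    enumSum Gs i = foldr (λ p acc → proj₁ p ℕ.* enum (proj₂ p) i ℕ.+ acc) 0 Gs

    module _ (s : ℚ) (0≤s : 0ℚ ≤ s) where

      weigh : List (ℕ × SimpleGraph n) → Weighting
      weigh = map (λ p → s * toℚ (proj₁ p) , proj₂ p)

      weigh-nonNeg : ∀ Gs → NonNegWeights (weigh Gs)
      weigh-nonNeg [] = []
      weigh-nonNeg ((k , G) ∷ Gs) = *-nonNeg 0≤s (toℚ-mono-≤ (ℕ.z≤n {k})) ∷ weigh-nonNeg Gs

      total-weigh : ∀ Gs → total (weigh Gs) ≡ s * toℚ (multiplicity Gs)
      total-weigh [] = sym (*-zeroʳ s)
      total-weigh ((k , G) ∷ Gs) = begin
        s * toℚ k + total (weigh Gs)              ≡⟨ cong (s * toℚ k +_) (total-weigh Gs) ⟩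
        s * toℚ k + s * toℚ (multiplicity Gs)     ≡⟨ *-distribˡ-+ s _ _ ⟨
        s * (toℚ k + toℚ (multiplicity Gs))       ≡⟨ cong (s *_) (toℚ-+ k _) ⟨
        s * toℚ (k ℕ.+ multiplicity Gs)           ∎
        where open ≡-Reasoning

      weightedSum-weigh : ∀ Gs i → weightedSum (weigh Gs) i ≡ s * toℚ (enumSum Gs i)
      weightedSum-weigh [] i = sym (*-zeroʳ s)
      weightedSum-weigh ((k , G) ∷ Gs) i = begin
        s * toℚ k * toℚ (enum G i) + weightedSum (weigh Gs) i         ≡⟨ cong₂ _+_ (*-assoc s _ _) (weightedSum-weigh Gs i) ⟩
        s * (toℚ k * toℚ (enum G i)) + s * toℚ (enumSum Gs i)         ≡⟨ *-distribˡ-+ s _ _ ⟨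
        s * (toℚ k * toℚ (enum G i) + toℚ (enumSum Gs i))             ≡⟨ cong (λ a → s * (a + toℚ (enumSum Gs i))) (toℚ-* k _) ⟨
        s * (toℚ (k ℕ.* enum G i) + toℚ (enumSum Gs i))               ≡⟨ cong (s *_) (toℚ-+ (k ℕ.* enum G i) _) ⟨
        s * toℚ (k ℕ.* enum G i ℕ.+ enumSum Gs i)                     ∎
        where open ≡-Reasoning

    -- The average is stated with its denominator cleared; here each multiplicity is divided by the
    -- total `M` to become a weight. Only the first multiplicity has to be positive, because
    -- extremality is applied to the first graph alone.
    vertex-average : ∀ {x e k G Gs} → IsVertex n x → x ≈ embed e →
                     let Gs′ = (suc k , G) ∷ Gs in (∀ i → multiplicity Gs′ ℕ.* e i ≡ enumSum Gs′ i) → x ≈ embed (enum G)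
    vertex-average {x} {e} {k} {G} {Gs} vx x≈e avg =
      vertex≈head {G = G} {weigh s 0≤s Gs} vx 0<w (weigh-nonNeg s 0≤s Gs) (trans (total-weigh s 0≤s Gs′) (*-inverseˡ (toℚ M)))
        λ i → begin
          x i                       ≡⟨ x≈e i ⟩
          toℚ (e i)                 ≡⟨ *-identityˡ _ ⟨
          1ℚ * toℚ (e i)            ≡⟨ cong (_* toℚ (e i)) (*-inverseˡ (toℚ M)) ⟨
          s * toℚ M * toℚ (e i)     ≡⟨ *-assoc s _ _ ⟩
          s * (toℚ M * toℚ (e i))   ≡⟨ cong (s *_) (toℚ-* M (e i)) ⟨
          s * toℚ (M ℕ.* e i)       ≡⟨ cong (λ a → s * toℚ a) (avg i) ⟩
          s * toℚ (enumSum Gs′ i)   ≡⟨ weightedSum-weigh s 0≤s Gs′ i ⟨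
          weightedSum (weigh s 0≤s Gs′) i ∎
      where
      open ≡-Reasoning
      Gs′ = (suc k , G) ∷ Gs
      M = multiplicity Gs′
      toℚ-pos : ∀ j → Positive (toℚ (suc j))
      toℚ-pos j = normalize-pos (suc j) 1
      instance
        M-pos : Positive (toℚ M)
        M-pos = toℚ-pos (k ℕ.+ multiplicity Gs)
        M-nonZero : NonZero (toℚ M)
        M-nonZero = pos⇒nonZero (toℚ M)
      s = 1/ toℚ M
      0<s = positive⁻¹ s {{1/pos⇒pos (toℚ M)}}
      0≤s = <⇒≤ 0<s
      0<w : 0ℚ < s * toℚ (suc k)
      0<w = subst (_< s * toℚ (suc k)) (*-zeroʳ s)
        (*-monoʳ-<-pos s {{1/pos⇒pos (toℚ M)}} (positive⁻¹ (toℚ (suc k)) {{toℚ-pos k}}))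

    -- A list of graphs with multiplicities whose first multiplicity is positive, being stored as its predecessor.
    Block : Set
    Block = (ℕ × SimpleGraph n) × List (ℕ × SimpleGraph n)

    graphs : Block → List (ℕ × SimpleGraph n)
    graphs ((k , G) , Gs) = (suc k , G) ∷ Gs

    blocks : ∀ {m} → (Fin m → Block) → List (ℕ × SimpleGraph n)
    blocks B = concat (tabulate (graphs ∘ B))

    multiplicity-++ : ∀ Gs Hs → multiplicity (Gs ++ Hs) ≡ multiplicity Gs ℕ.+ multiplicity Hs
    multiplicity-++ [] Hs = refl
    multiplicity-++ ((k , G) ∷ Gs) Hs = trans (cong (k ℕ.+_) (multiplicity-++ Gs Hs)) (sym (ℕ.+-assoc k _ _))

    enumSum-++ : ∀ Gs Hs i → enumSum (Gs ++ Hs) i ≡ enumSum Gs i ℕ.+ enumSum Hs i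
    enumSum-++ [] Hs i = refl
    enumSum-++ ((k , G) ∷ Gs) Hs i = trans (cong (k ℕ.* enum G i ℕ.+_) (enumSum-++ Gs Hs i)) (sym (ℕ.+-assoc (k ℕ.* enum G i) _ _))

    multiplicity-blocks : ∀ {m} (B : Fin m → Block) M → (∀ j → multiplicity (graphs (B j)) ≡ M) → multiplicity (blocks B) ≡ m ℕ.* M
    multiplicity-blocks {zero} B M _ = refl
    multiplicity-blocks {suc m} B M B≡M = trans (multiplicity-++ (graphs (B Fin.zero)) _)
      (cong₂ ℕ._+_ (B≡M Fin.zero) (multiplicity-blocks (B ∘ Fin.suc) M (B≡M ∘ Fin.suc)))

    enumSum-blocks : ∀ {m} (B : Fin m → Block) i → enumSum (blocks B) i ≡ ∑.sum (λ j → enumSum (graphs (B j)) i)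
    enumSum-blocks {zero} B i = refl
    enumSum-blocks {suc m} B i = trans (enumSum-++ (graphs (B Fin.zero)) _ i)
      (cong (enumSum (graphs (B Fin.zero)) i ℕ.+_) (enumSum-blocks (B ∘ Fin.suc) i))

    -- Each block represents one point of an average, and the common size M gives these points equal
    -- weight. The conclusion names the very first graph, whose multiplicity is positive by the form
    -- of a `Block`.
    vertex≈block : ∀ {x e m} (B : Fin (suc m) → Block) M → IsVertex n x → x ≈ embed e →
                   (∀ j → multiplicity (graphs (B j)) ≡ M) →
                   (∀ i → suc m ℕ.* M ℕ.* e i ≡ ∑.sum (λ j → enumSum (graphs (B j)) i)) →
                   x ≈ embed (enum (proj₂ (proj₁ (B Fin.zero))))
    vertex≈block {x} {e} B M vx x≈e B≡M avg =
      vertex-average {x} {e} {proj₁ (proj₁ (B Fin.zero))} {proj₂ (proj₁ (B Fin.zero))} {proj₂ (B Fin.zero) ++ blocks (B ∘ Fin.suc)} vx x≈e λ i →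
      trans (cong (ℕ._* e i) (multiplicity-blocks B M B≡M)) (trans (avg i) (sym (enumSum-blocks B i)))

    -- Exposed points are extreme. Both hypotheses speak about graphs only, where they can be
    -- checked degree by degree; linearity carries them over to the hull.
    module Minimiser (c : Fin n → ℕ) (b : ℕ) (x : Fin n → ℕ)
                     (bound : ∀ G → b ℕ.≤ ∑.sum (λ i → c i ℕ.* enum G i))
                     (tight : ∀ G → ∑.sum (λ i → c i ℕ.* enum G i) ℕ.≤ b → enum G ≈ℕ x) where

      ⟨c,_⟩ : Point n → ℚ
      ⟨c, y ⟩ = ∑ℚ.sum (λ i → toℚ (c i) * y i)

      ⟨c⟩-cong : ∀ {y z} → y ≈ z → ⟨c, y ⟩ ≡ ⟨c, z ⟩
      ⟨c⟩-cong y≈z = ∑ℚ.sum-cong-≗ (λ i → cong (toℚ (c i) *_) (y≈z i))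

      ⟨c⟩-linear : ∀ s t y z → ⟨c, (λ i → s * y i + t * z i) ⟩ ≡ s * ⟨c, y ⟩ + t * ⟨c, z ⟩
      ⟨c⟩-linear s t y z = begin
        ∑ℚ.sum (λ i → toℚ (c i) * (s * y i + t * z i))
          ≡⟨ ∑ℚ.sum-cong-≗ (λ i → solve 5 (λ c s t y z → c :* (s :* y :+ t :* z) := s :* (c :* y) :+ t :* (c :* z)) refl (toℚ (c i)) s t (y i) (z i)) ⟩
        ∑ℚ.sum (λ i → s * (toℚ (c i) * y i) + t * (toℚ (c i) * z i))
          ≡⟨ ∑ℚ.∑-distrib-+ (λ i → s * (toℚ (c i) * y i)) (λ i → t * (toℚ (c i) * z i)) ⟩
        ∑ℚ.sum (λ i → s * (toℚ (c i) * y i)) + ∑ℚ.sum (λ i → t * (toℚ (c i) * z i))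
          ≡⟨ cong₂ _+_ (∑ℚ.*-distribˡ-sum s (λ i → toℚ (c i) * y i)) (∑ℚ.*-distribˡ-sum t (λ i → toℚ (c i) * z i)) ⟨
        s * ⟨c, y ⟩ + t * ⟨c, z ⟩ ∎
        where open ≡-Reasoning

      ⟨c⟩-embed : ∀ e → ⟨c, embed e ⟩ ≡ toℚ (∑.sum (λ i → c i ℕ.* e i))
      ⟨c⟩-embed e = sym (trans (toℚ-sum (λ i → c i ℕ.* e i)) (∑ℚ.sum-cong-≗ (λ i → toℚ-* (c i) (e i))))

      ⟨c⟩-weightedSum : ∀ w G L → ⟨c, weightedSum ((w , G) ∷ L) ⟩ ≡ w * ⟨c, embed (enum G) ⟩ + ⟨c, weightedSum L ⟩
      ⟨c⟩-weightedSum w G L = trans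
        (⟨c⟩-cong {weightedSum ((w , G) ∷ L)} {λ i → w * embed (enum G) i + 1ℚ * weightedSum L i}
          (λ i → cong (w * toℚ (enum G i) +_) (sym (*-identityˡ (weightedSum L i)))))
        (trans (⟨c⟩-linear w 1ℚ (embed (enum G)) (weightedSum L)) (cong (w * ⟨c, embed (enum G) ⟩ +_) (*-identityˡ _)))

      bound-graph : ∀ {w} G → 0ℚ ≤ w → w * toℚ b ≤ w * ⟨c, embed (enum G) ⟩
      bound-graph {w} G 0≤w = *-monoˡ-≤-nonNeg w {{nonNegative 0≤w}}
        (subst (toℚ b ≤_) (sym (⟨c⟩-embed (enum G))) (toℚ-mono-≤ (bound G)))

      -- Scaled by `total L`, because the induction passes to tails of the list, whose weights no
      -- longer sum to 1. `tight-weightedSum` has its form for the same reason.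
      bound-weightedSum : ∀ {L} → NonNegWeights L → total L * toℚ b ≤ ⟨c, weightedSum L ⟩
      bound-weightedSum [] = ≤-reflexive (trans (*-zeroˡ (toℚ b)) (sym (trans
        (∑ℚ.sum-cong-≗ (λ i → *-zeroʳ (toℚ (c i)))) (∑ℚ.sum-replicate-zero n))))
      bound-weightedSum {(w , G) ∷ L} (p ∷ ps) = subst₂ _≤_ (sym (*-distribʳ-+ (toℚ b) w (total L)))
        (sym (⟨c⟩-weightedSum w G L)) (+-mono-≤ (bound-graph G p) (bound-weightedSum ps))

      tight-weightedSum : ∀ {L} → NonNegWeights L → ⟨c, weightedSum L ⟩ ≤ total L * toℚ b →
                          ∀ i → weightedSum L i ≡ total L * toℚ (x i)
      tight-weightedSum [] _ i = sym (*-zeroˡ (toℚ (x i)))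
      tight-weightedSum {(w , G) ∷ L} (p ∷ ps) le i = trans
        (cong₂ _+_ head≡ (tight-weightedSum ps (proj₂ both) i)) (sym (*-distribʳ-+ (toℚ (x i)) w (total L)))
        where
        both : w * ⟨c, embed (enum G) ⟩ ≤ w * toℚ b × ⟨c, weightedSum L ⟩ ≤ total L * toℚ b
        both = +-tight (bound-graph G p) (bound-weightedSum ps)
          (subst₂ _≤_ (⟨c⟩-weightedSum w G L) (*-distribʳ-+ (toℚ b) w (total L)) le)
        head≡ : w * toℚ (enum G i) ≡ w * toℚ (x i)
        -- A graph of weight zero may be far from the minimum, but contributes 0 on both sides. A
        -- positive weight cancels, and `tight` applies.
        head≡ = split (w ≟ 0ℚ)
          where
          split : Dec (w ≡ 0ℚ) → w * toℚ (enum G i) ≡ w * toℚ (x i)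
          split (yes w≡0) = trans (cong (_* toℚ (enum G i)) w≡0) (trans (*-zeroˡ (toℚ (enum G i)))
            (sym (trans (cong (_* toℚ (x i)) w≡0) (*-zeroˡ (toℚ (x i))))))
          split (no w≢0) = cong (λ a → w * toℚ a) (tight G (toℚ-cancel-≤ (subst (_≤ toℚ b) (⟨c⟩-embed (enum G))
            (*-cancelˡ-≤-pos w {{positive (≤∧≢⇒< p (w≢0 ∘ sym))}} (proj₁ both)))) i)

      bound∈E : ∀ {y} → InE n y → toℚ b ≤ ⟨c, y ⟩
      bound∈E (L , nn , sum≡1 , y≈) = subst₂ _≤_ (trans (cong (_* toℚ b) sum≡1) (*-identityˡ (toℚ b)))
        (sym (⟨c⟩-cong y≈)) (bound-weightedSum nn)

      tight∈E : ∀ {y} → InE n y → ⟨c, y ⟩ ≤ toℚ b → y ≈ embed x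
      tight∈E (L , nn , sum≡1 , y≈) le i = trans (y≈ i) (trans
        (tight-weightedSum nn (subst₂ _≤_ (⟨c⟩-cong y≈) (sym (trans (cong (_* toℚ b) sum≡1) (*-identityˡ (toℚ b)))) le) i)
        (trans (cong (_* toℚ (x i)) sum≡1) (*-identityˡ _)))

      isVertex : ∀ G → ∑.sum (λ i → c i ℕ.* enum G i) ℕ.≤ b → IsVertex n (embed x)
      isVertex G G≤b = x∈E , extreme
        where
        G≈x : enum G ≈ℕ x
        G≈x = tight G G≤b
        x≡G : embed x ≈ embed (enum G)
        x≡G i = cong toℚ (sym (G≈x i))
        x∈E : InE n (embed x)
        x∈E = let L , nn , sum≡1 , eq = graph∈E G in L , nn , sum≡1 , λ i → trans (x≡G i) (eq i)
        extreme : ∀ y z t → InE n y → InE n z → 0ℚ < t → t < 1ℚ →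
                  (∀ i → embed x i ≡ t * y i + (1ℚ - t) * z i) → y ≈ z
        -- The value at `embed x` is at most b, the values at y and z are at least b, and both
        -- coefficients are positive. So y and z attain b, and each of them is `embed x`.
        extreme y z t y∈E z∈E 0<t t<1 x≡ i = trans
          (tight∈E y∈E (*-cancelˡ-≤-pos t (proj₁ both)) i) (sym (tight∈E z∈E (*-cancelˡ-≤-pos (1ℚ - t) (proj₂ both)) i))
          where
          instance
            t-pos : Positive t
            t-pos = positive 0<t
            1-t-pos : Positive (1ℚ - t)
            1-t-pos = positive (subst (_< 1ℚ - t) (+-inverseʳ t) (+-monoˡ-< (- t) t<1))
          le : t * ⟨c, y ⟩ + (1ℚ - t) * ⟨c, z ⟩ ≤ t * toℚ b + (1ℚ - t) * toℚ b
          le = subst₂ _≤_ (trans (sym (trans (⟨c⟩-cong x≡G) (⟨c⟩-embed (enum G)))) (trans (⟨c⟩-cong x≡) (⟨c⟩-linear t (1ℚ - t) y z)))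
            (solve 2 (λ t b → b := t :* b :+ (con 1ℚ :- t) :* b) refl t (toℚ b)) (toℚ-mono-≤ G≤b)
          both : t * ⟨c, y ⟩ ≤ t * toℚ b × (1ℚ - t) * ⟨c, z ⟩ ≤ (1ℚ - t) * toℚ b
          both = +-tight (*-monoˡ-≤-nonNeg t {{pos⇒nonNeg t}} (bound∈E y∈E))
            (*-monoˡ-≤-nonNeg (1ℚ - t) {{pos⇒nonNeg (1ℚ - t)}} (bound∈E z∈E)) le

open Convexity using (embed-injective; enum; Block; graphs; multiplicity; enumSum; vertex≈graph; vertex≈block; module Minimiser)
open import Data.Bool.Base using (Bool; true; false; if_then_else_; not; T; _∧_)
open import Data.Bool.ListAction using (any)
open import Data.Bool.Properties using (T-∨; T-∧; T?)
open import Data.Empty using (⊥-elim)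
open import Data.Fin.Properties using (toℕ<n; toℕ-fromℕ; toℕ-fromℕ<; toℕ-injective; punchInᵢ≢i; any?; combine-remQuot; remQuot-combine)
open import Data.List.Membership.Propositional using (_∈_; _∉_; find; lose)
open import Data.List.Membership.Propositional.Properties
open import Data.List.Membership.Propositional.Properties.WithK using (unique∧set⇒bag)
open import Data.List.Properties using (length-map; length-++; length-upTo; map-upTo; map-++)
open import Data.List.Relation.Binary.BagAndSetEquality using (∼bag⇒↭)
open import Data.List.Relation.Binary.Permutation.Propositional.Properties using (↭-length)
open import Data.List.Relation.Unary.AllPairs using ([]; _∷_)
open import Data.List.Relation.Unary.Any using (here; there)
open import Data.List.Relation.Unary.Any.Properties using (any⁺; any⁻)
open import Data.List.Relation.Unary.Unique.Propositional using (Unique)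
import Data.List.Relation.Unary.Unique.Propositional.Properties as Unique
open import Data.Nat.Base hiding (parity)
open import Data.Nat.DivMod
open import Data.Nat.Divisibility using (_∣_; _∤_; divides; _∣?_; _∣0; n∣m*n; ∣m+n∣m⇒∣n; ∣m∣n⇒∣m+n)
open import Data.Nat.Properties
open import Data.Nat.Solver using (module +-*-Solver)
open import Function.Bundles using (_⇔_; mk⇔; Equivalence)
open import Algebra.Properties.Semiring.Sum +-*-semiring
open import Data.List.Membership.DecPropositional _≟_ using (_∈?_)
open Equivalence using (to; from)
open +-*-Solver using (solve; _:=_; _:+_; _:*_; con)

-- Edge lists and neighbour lists

count-filter : ∀ {n m} (p : Fin m → Bool) (f : Fin n → Fin m) → count (p ∘ f) ≡ length (filterᵇ p (tabulate f))
count-filter {zero}  p f = refl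
count-filter {suc n} p f with p (f Fin.zero)
... | true  = cong suc (count-filter p (f ∘ Fin.suc))
... | false = count-filter p (f ∘ Fin.suc)

unique-length : ∀ {A : Set} {xs ys : List A} → Unique xs → Unique ys → (∀ {x} → x ∈ xs ⇔ x ∈ ys) → length xs ≡ length ys
unique-length uxs uys eq = ↭-length (∼bag⇒↭ (unique∧set⇒bag uxs uys eq))

-- Reduces a degree to a neighbour list in `ℕ`: the list of indices satisfying p and the given list
-- are duplicate-free with the same elements, hence permutations of each other.
count-enumerated : ∀ {n} (p : Fin n → Bool) {xs : List ℕ} → Unique xs → (∀ {x} → x ∈ xs → x < n) →
                   (∀ v → T (p v) ⇔ toℕ v ∈ xs) → count p ≡ length xs
count-enumerated {n} p {xs} uxs xs<n eq = begin
  count p                                         ≡⟨ count-filter p id ⟩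
  length (filterᵇ p (allFin n))                   ≡⟨ length-map toℕ (filterᵇ p (allFin n)) ⟨
  length (map toℕ (filterᵇ p (allFin n)))         ≡⟨ unique-length unique uxs (mk⇔ ⇒ ⇐) ⟩
  length xs                                       ∎
  where
  open ≡-Reasoning
  unique = Unique.map⁺ toℕ-injective (Unique.filter⁺ (T? ∘ p) (Unique.allFin⁺ n))
  ⇒ : ∀ {x} → x ∈ map toℕ (filterᵇ p (allFin n)) → x ∈ xs
  ⇒ x∈ with v , v∈ , refl ← ∈-map⁻ toℕ x∈ = to (eq v) (proj₂ (∈-filter⁻ (T? ∘ p) {xs = allFin n} v∈))
  ⇐ : ∀ {x} → x ∈ xs → x ∈ map toℕ (filterᵇ p (allFin n))
  ⇐ {x} x∈ = subst (_∈ _) v≡x (∈-map⁺ toℕ (∈-filter⁺ (T? ∘ p) (∈-allFin v) (from (eq v) (subst (_∈ xs) (sym v≡x) x∈))))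
    where
    v = fromℕ< (xs<n x∈)
    v≡x = toℕ-fromℕ< (xs<n x∈)

Linked : List Edge → ℕ → ℕ → Set
Linked E u v = (u , v) ∈ E ⊎ (v , u) ∈ E

sameEdge⁻ : ∀ a b u v → T (sameEdge (a , b) (u , v)) → (a ≡ u × b ≡ v) ⊎ (a ≡ v × b ≡ u)
sameEdge⁻ a b u v t = Sum.map both both (to T-∨ t)
  where
  both : ∀ {a b u v} → T ((a ≡ᵇ u) ∧ (b ≡ᵇ v)) → a ≡ u × b ≡ v
  both t = let p , q = to T-∧ t in ≡ᵇ⇒≡ _ _ p , ≡ᵇ⇒≡ _ _ q

sameEdge-refl : ∀ a b → T (sameEdge (a , b) (a , b))
sameEdge-refl a b = from T-∨ (inj₁ (from T-∧ (≡⇒≡ᵇ a a refl , ≡⇒≡ᵇ b b refl)))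

sameEdge-swap : ∀ a b → T (sameEdge (a , b) (b , a))
sameEdge-swap a b = from T-∨ (inj₂ (from T-∧ (≡⇒≡ᵇ a a refl , ≡⇒≡ᵇ b b refl)))

T-adjOf : ∀ {n} E (u v : Fin n) → T (adjOf E u v) ⇔ Linked E (toℕ u) (toℕ v)
T-adjOf E u v = mk⇔ ⇒ ⇐
  where
  ⇒ : T (adjOf E u v) → Linked E (toℕ u) (toℕ v)
  ⇒ t with (a , b) , e∈ , s ← find (any⁻ _ E t) with sameEdge⁻ a b (toℕ u) (toℕ v) s
  ... | inj₁ (refl , refl) = inj₁ e∈
  ... | inj₂ (refl , refl) = inj₂ e∈
  ⇐ : Linked E (toℕ u) (toℕ v) → T (adjOf E u v)
  ⇐ (inj₁ e∈) = any⁺ _ (lose e∈ (sameEdge-refl (toℕ u) (toℕ v)))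
  ⇐ (inj₂ e∈) = any⁺ _ (lose e∈ (sameEdge-swap (toℕ v) (toℕ u)))

T⇔⇒≡ : ∀ {a b} → T a ⇔ T b → a ≡ b
T⇔⇒≡ {true}  {true}  _ = refl
T⇔⇒≡ {false} {false} _ = refl
T⇔⇒≡ {true}  {false} e = ⊥-elim (to e _)
T⇔⇒≡ {false} {true}  e = ⊥-elim (from e _)

adjOf-sym : ∀ {n} E (u v : Fin n) → adjOf E u v ≡ adjOf E v u
adjOf-sym E u v = T⇔⇒≡ (mk⇔ (from (T-adjOf E v u) ∘ Sum.swap ∘ to (T-adjOf E u v))
                            (from (T-adjOf E u v) ∘ Sum.swap ∘ to (T-adjOf E v u)))

-- Symmetry is automatic, since `adjOf` matches an edge in either orientation; only loops have to be
-- excluded.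
edgeGraph : ∀ {n} E → (∀ v → v < n → (v , v) ∉ E) → SimpleGraph n
edgeGraph E irr = record
  { adj = adjOf E
  ; sym = adjOf-sym E
  ; irrefl = λ v → T⇔⇒≡ (mk⇔ ([ irr _ (toℕ<n v) , irr _ (toℕ<n v) ]′ ∘ to (T-adjOf E v v)) λ ())
  }

deg-enumerated : ∀ {n} E (u : Fin n) {xs} → Unique xs → (∀ {x} → x ∈ xs → x < n) →
                 (∀ {v} → v < n → Linked E (toℕ u) v ⇔ v ∈ xs) → deg (adjOf {n} E) u ≡ length xs
deg-enumerated E u uxs xs<n eq = count-enumerated _ uxs xs<n λ v →
  mk⇔ (to (eq (toℕ<n v)) ∘ to (T-adjOf E u v)) (from (T-adjOf E u v) ∘ from (eq (toℕ<n v)))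

∈-pairs : ∀ (f g : ℕ → ℕ) k {a b} → (a , b) ∈ map (λ i → (f i , g i)) (upTo k) ⇔ (∃[ i ] (i < k × a ≡ f i × b ≡ g i))
∈-pairs f g k = mk⇔ ⇒ ⇐
  where
  ⇒ : ∀ {a b} → (a , b) ∈ map (λ i → (f i , g i)) (upTo k) → ∃[ i ] (i < k × a ≡ f i × b ≡ g i)
  ⇒ e with i , i∈ , refl ← ∈-map⁻ _ e = i , ∈-upTo⁻ i∈ , refl , refl
  ⇐ : ∀ {a b} → ∃[ i ] (i < k × a ≡ f i × b ≡ g i) → (a , b) ∈ map (λ i → (f i , g i)) (upTo k)
  ⇐ (i , i<k , refl , refl) = ∈-map⁺ _ (∈-upTo⁺ i<k)

∈-circEdges : ∀ m r {a b} → (a , b) ∈ circEdges (suc m) r ⇔ (a < suc m × ∃[ j ] (j < ⌊ r /2⌋ × b ≡ (a + suc j) % suc m))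
∈-circEdges m r = mk⇔ ⇒ ⇐
  where
  row : ℕ → List Edge
  row i = map (λ j → (i , (i + suc j) % suc m)) (upTo ⌊ r /2⌋)
  ⇒ : ∀ {a b} → (a , b) ∈ circEdges (suc m) r → a < suc m × ∃[ j ] (j < ⌊ r /2⌋ × b ≡ (a + suc j) % suc m)
  ⇒ e with i , i∈ , e∈ ← find (∈-concatMap⁻ row {xs = upTo (suc m)} e) with j , j<k , refl , refl ← to (∈-pairs (λ _ → i) (λ j → (i + suc j) % suc m) _) e∈
    = ∈-upTo⁻ i∈ , j , j<k , refl
  ⇐ : ∀ {a b} → a < suc m × ∃[ j ] (j < ⌊ r /2⌋ × b ≡ (a + suc j) % suc m) → (a , b) ∈ circEdges (suc m) r
  ⇐ (a<n , j , j<k , refl) = ∈-concatMap⁺ row (lose (∈-upTo⁺ a<n) (from (∈-pairs _ _ _) (j , j<k , refl , refl)))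

linked-++⁻ : ∀ E {F u v} → Linked (E ++ F) u v → Linked E u v ⊎ Linked F u v
linked-++⁻ E (inj₁ e) = Sum.map inj₁ inj₁ (∈-++⁻ E e)
linked-++⁻ E (inj₂ e) = Sum.map inj₂ inj₂ (∈-++⁻ E e)

⌊k*2/2⌋≡k : ∀ k → ⌊ k * 2 /2⌋ ≡ k
⌊k*2/2⌋≡k zero    = refl
⌊k*2/2⌋≡k (suc k) = cong suc (⌊k*2/2⌋≡k k)

-- The first q edges {i, h + i} of the perfect matching M_{2h}, and the vertices that they cover.
rungs : ℕ → ℕ → List Edge
rungs h q = map (λ i → (i , h + i)) (upTo q)

ends : ℕ → ℕ → List ℕ
ends h q = upTo q ++ map (h +_) (upTo q)

∈-ends⁻ : ∀ h q {u} → u ∈ ends h q → u < q ⊎ (∃[ i ] (i < q × u ≡ h + i))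
∈-ends⁻ h q u∈ with ∈-++⁻ (upTo q) u∈
... | inj₁ p = inj₁ (∈-upTo⁻ p)
... | inj₂ p = let i , i∈ , eq = ∈-map⁻ (h +_) p in inj₂ (i , ∈-upTo⁻ i∈ , eq)

length-ends : ∀ h q → length (ends h q) ≡ q + q
length-ends h q = trans (length-++ (upTo q))
  (cong₂ _+_ (length-upTo q) (trans (length-map (h +_) (upTo q)) (length-upTo q)))

-- The shape of `edgesRS` with its halves as parameters: h for half of N, and q for s/2. If E
-- contains the rungs, then each end of a deleted rung loses its antipode and gains the hub N, which
-- keeps its degree.
withHub : ℕ → ℕ → ℕ → List Edge → List Edge
withHub N h q E = filterᵇ (λ e → not (any (sameEdge e) (rungs h q))) E
               ++ map (λ i → (i , N)) (upTo q) ++ map (λ i → (h + i , N)) (upTo q)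

T-any-sameEdge : ∀ a b E → T (any (sameEdge (a , b)) E) ⇔ Linked E a b
T-any-sameEdge a b E = mk⇔ ⇒ ⇐
  where
  ⇒ : T (any (sameEdge (a , b)) E) → Linked E a b
  ⇒ t with (u , v) , e∈ , s ← find (any⁻ _ E t) with sameEdge⁻ a b u v s
  ... | inj₁ (refl , refl) = inj₁ e∈
  ... | inj₂ (refl , refl) = inj₂ e∈
  ⇐ : Linked E a b → T (any (sameEdge (a , b)) E)
  ⇐ (inj₁ e∈) = any⁺ _ (lose e∈ (sameEdge-refl a b))
  ⇐ (inj₂ e∈) = any⁺ _ (lose e∈ (sameEdge-swap a b))

T-not : ∀ {b} → T (not b) ⇔ (¬ T b)
T-not {true}  = mk⇔ (λ ()) (λ ¬t → ¬t _)
T-not {false} = mk⇔ (λ _ ()) _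

∈-withHub : ∀ N h q E {a b} → (a , b) ∈ withHub N h q E ⇔
            (((a , b) ∈ E × ¬ Linked (rungs h q) a b) ⊎ (b ≡ N × a ∈ ends h q))
∈-withHub N h q E {a} {b} = mk⇔ ⇒ ⇐
  where
  kept : Edge → Bool
  kept e = not (any (sameEdge e) (rungs h q))
  spokes = map (λ i → (i , N)) (upTo q)
  ⇒ : (a , b) ∈ withHub N h q E → ((a , b) ∈ E × ¬ Linked (rungs h q) a b) ⊎ (b ≡ N × a ∈ ends h q)
  ⇒ e with ∈-++⁻ (filterᵇ kept E) e
  ... | inj₁ e′ = let e∈ , t = ∈-filter⁻ (T? ∘ kept) {xs = E} e′ in
                  inj₁ (e∈ , to T-not t ∘ from (T-any-sameEdge a b (rungs h q)))
  ... | inj₂ e′ with ∈-++⁻ spokes e′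
  ...   | inj₁ e″ with i , i<q , refl , refl ← to (∈-pairs id (λ _ → N) q) e″ = inj₂ (refl , ∈-++⁺ˡ (∈-upTo⁺ i<q))
  ...   | inj₂ e″ with i , i<q , refl , refl ← to (∈-pairs (h +_) (λ _ → N) q) e″ =
            inj₂ (refl , ∈-++⁺ʳ (upTo q) (∈-map⁺ (h +_) (∈-upTo⁺ i<q)))
  ⇐ : ((a , b) ∈ E × ¬ Linked (rungs h q) a b) ⊎ (b ≡ N × a ∈ ends h q) → (a , b) ∈ withHub N h q E
  ⇐ (inj₁ (e∈ , ¬l)) = ∈-++⁺ˡ (∈-filter⁺ (T? ∘ kept) e∈ (from T-not (¬l ∘ to (T-any-sameEdge a b (rungs h q)))))
  ⇐ (inj₂ (refl , a∈)) with ∈-ends⁻ h q a∈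
  ... | inj₁ a<q = ∈-++⁺ʳ (filterᵇ kept E) (∈-++⁺ˡ (from (∈-pairs id (λ _ → N) q) (_ , a<q , refl , refl)))
  ... | inj₂ (i , i<q , refl) = ∈-++⁺ʳ (filterᵇ kept E) (∈-++⁺ʳ spokes (from (∈-pairs (h +_) (λ _ → N) q) (i , i<q , refl , refl)))

-- Circulant graphs

module Rotation (m : ℕ) where

  N = suc m

  rot : ℕ → ℕ → ℕ
  rot u a = (u + a) % N

  rot<N : ∀ u a → rot u a < N
  rot<N u a = m%n<n (u + a) N

  %-absorb : ∀ a b → (a + b % N) % N ≡ (a + b) % N
  %-absorb a b = begin
    (a + b % N) % N               ≡⟨ %-distribˡ-+ a (b % N) N ⟩
    (a % N + b % N % N) % N       ≡⟨ cong (λ z → (a % N + z) % N) (m%n%n≡m%n b N) ⟩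
    (a % N + b % N) % N           ≡⟨ %-distribˡ-+ a b N ⟨
    (a + b) % N                   ∎
    where open ≡-Reasoning

  rot-comm : ∀ u a → rot u a ≡ rot a u
  rot-comm u a = cong (_% N) (+-comm u a)

  rot-cancel : ∀ {u a} → u ≤ N → a < N → rot (rot u a) (N ∸ u) ≡ a
  rot-cancel {u} {a} u≤N a<N = begin
    rot (rot u a) (N ∸ u)      ≡⟨ rot-comm (rot u a) (N ∸ u) ⟩
    rot (N ∸ u) ((u + a) % N)  ≡⟨ %-absorb (N ∸ u) (u + a) ⟩
    (N ∸ u + (u + a)) % N      ≡⟨ cong (_% N) (+-assoc (N ∸ u) u a) ⟨
    (N ∸ u + u + a) % N        ≡⟨ cong (λ z → (z + a) % N) (m∸n+n≡m u≤N) ⟩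
    (N + a) % N                ≡⟨ rot-comm N a ⟩
    (a + N) % N                ≡⟨ [m+n]%n≡m%n a N ⟩
    a % N                      ≡⟨ m<n⇒m%n≡m a<N ⟩
    a                          ∎
    where open ≡-Reasoning

  rot-injective : ∀ {u a b} → u < N → a < N → b < N → rot u a ≡ rot u b → a ≡ b
  rot-injective {u} u<N a<N b<N eq = trans (sym (rot-cancel (<⇒≤ u<N) a<N))
    (trans (cong (λ z → rot z (N ∸ u)) eq) (rot-cancel (<⇒≤ u<N) b<N))

  -- Turns an edge listed at its other end into an offset seen from u: the offset a becomes N - a.
  rot-back : ∀ {u v a} → v < N → a ≤ N → u ≡ rot v a → v ≡ rot u (N ∸ a)
  rot-back {v = v} {a} v<N a≤N refl = sym (trans (cong (λ z → rot z (N ∸ a)) (rot-comm v a)) (rot-cancel a≤N v<N))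

  rot-zero : ∀ {u} → u < N → rot u 0 ≡ u
  rot-zero {u} u<N = trans (cong (_% N) (+-identityʳ u)) (m<n⇒m%n≡m u<N)

  -- G_N(2k) joins u to u + a mod N for a = 1, …, k and a = N - 1, …, N - k, where N - (j + 1) = m - j.
  offsets : ℕ → List ℕ
  offsets k = map suc (upTo k) ++ map (m ∸_) (upTo k)

  ∈-offsets⁻ : ∀ k {a} → a ∈ offsets k → (∃[ j ] (j < k × a ≡ suc j)) ⊎ (∃[ j ] (j < k × a ≡ m ∸ j))
  ∈-offsets⁻ k a∈ = Sum.map (f suc) (f (m ∸_)) (∈-++⁻ (map suc (upTo k)) a∈)
    where
    f : ∀ (g : ℕ → ℕ) {a} → a ∈ map g (upTo k) → ∃[ j ] (j < k × a ≡ g j)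
    f g e = let j , j∈ , eq = ∈-map⁻ g e in j , ∈-upTo⁻ j∈ , eq

  length-offsets : ∀ k → length (offsets k) ≡ k + k
  length-offsets k = trans (length-++ (map suc (upTo k)))
    (cong₂ _+_ (trans (length-map suc (upTo k)) (length-upTo k)) (trans (length-map (m ∸_) (upTo k)) (length-upTo k)))

  module _ {k : ℕ} (2k≤m : k + k ≤ m) where

    k≤m : k ≤ m
    k≤m = ≤-trans (m≤m+n k k) 2k≤m

    offsets-positive : ∀ {a} → a ∈ offsets k → 0 < a
    offsets-positive a∈ with ∈-offsets⁻ k a∈
    ... | inj₁ (j , _ , refl) = z<s
    ... | inj₂ (j , j<k , refl) = m<n⇒0<n∸m (<-≤-trans j<k k≤m)

    offsets<N : ∀ {a} → a ∈ offsets k → a < N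
    offsets<N a∈ with ∈-offsets⁻ k a∈
    ... | inj₁ (j , j<k , refl) = s≤s (≤-trans j<k k≤m)
    ... | inj₂ (j , _ , refl) = s≤s (m∸n≤m m j)

    unique-offsets : Unique (offsets k)
    unique-offsets = Unique.++⁺ (Unique.map⁺ suc-injective (Unique.upTo⁺ k)) second disjoint
      where
      second : Unique (map (m ∸_) (upTo k))
      second = subst Unique (sym (map-upTo (m ∸_) k))
        (Unique.applyUpTo⁺₁ (m ∸_) k λ i<j j<k → <⇒≢ (∸-monoʳ-< i<j (≤-trans (<⇒≤ j<k) k≤m)) ∘ sym)
      -- A common offset i + 1 = m - j would give m = i + 1 + j < 2k, against `2k≤m`. Here the bound
      -- r < n enters.
      disjoint : ∀ {a} → ¬ (a ∈ map suc (upTo k) × a ∈ map (m ∸_) (upTo k))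
      disjoint (p , q) with i , i∈ , refl ← ∈-map⁻ suc p with j , j∈ , eq ← ∈-map⁻ (m ∸_) q =
        <-irrefl refl (begin-strict
          m               ≡⟨ m∸n+n≡m (≤-trans (<⇒≤ (∈-upTo⁻ j∈)) k≤m) ⟨
          m ∸ j + j       ≡⟨ cong (_+ j) eq ⟨
          suc i + j       <⟨ +-mono-≤-< (∈-upTo⁻ i∈) (∈-upTo⁻ j∈) ⟩
          k + k           ≤⟨ 2k≤m ⟩
          m               ∎)
        where open ≤-Reasoning

    -- An edge listed at u has offset j + 1; an edge listed at v has offset N - (j + 1) = m - j when
    -- seen from u. These are the two halves of `offsets k`.
    linked-circ : ∀ r → ⌊ r /2⌋ ≡ k → ∀ {u v} → u < N → v < N →
                  Linked (circEdges N r) u v ⇔ v ∈ map (rot u) (offsets k)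
    linked-circ r refl {u} {v} u<N v<N = mk⇔ ⇒ ⇐
      where
      ⇒ : Linked (circEdges N r) u v → v ∈ map (rot u) (offsets k)
      ⇒ (inj₁ e) with _ , j , j<k , refl ← to (∈-circEdges m r) e =
        ∈-map⁺ (rot u) (∈-++⁺ˡ (∈-map⁺ suc (∈-upTo⁺ j<k)))
      ⇒ (inj₂ e) with _ , j , j<k , eq ← to (∈-circEdges m r) e =
        subst (_∈ map (rot u) (offsets k)) (sym (rot-back v<N (≤-trans (<-≤-trans j<k k≤m) (n≤1+n m)) eq))
          (∈-map⁺ (rot u) (∈-++⁺ʳ (map suc (upTo k)) (∈-map⁺ (m ∸_) (∈-upTo⁺ j<k))))
      ⇐ : v ∈ map (rot u) (offsets k) → Linked (circEdges N r) u v
      ⇐ v∈ with a , a∈ , eq ← ∈-map⁻ (rot u) v∈ with ∈-offsets⁻ k a∈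
      ... | inj₁ (j , j<k , refl) = inj₁ (from (∈-circEdges m r) (u<N , j , j<k , eq))
      ... | inj₂ (j , j<k , refl) = inj₂ (from (∈-circEdges m r) (v<N , j , j<k ,
              trans (rot-back u<N (≤-trans (m∸n≤m m j) (n≤1+n m)) eq) (cong (rot v) N∸[m∸j])))
        where
        j≤m = <⇒≤ (<-≤-trans j<k k≤m)
        N∸[m∸j] : N ∸ (m ∸ j) ≡ suc j
        N∸[m∸j] = trans (+-∸-assoc 1 (m∸n≤m m j)) (cong suc (m∸[m∸n]≡n j≤m))

  unique-rot : ∀ {u as} → u < N → (∀ {a : ℕ} → a ∈ as → a < N) → Unique as → Unique (map (rot u) as)
  unique-rot u<N as<N [] = []
  unique-rot u<N as<N (a∉ ∷ uas) =
    All.map⁺ (All.tabulate λ b∈ eq → All.lookup a∉ b∈ (rot-injective u<N (as<N (here refl)) (as<N (there b∈)) eq))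
    ∷ unique-rot u<N (as<N ∘ there) uas

  map-rot<N : ∀ u as {x} → x ∈ map (rot u) as → x < N
  map-rot<N u as x∈ with a , _ , refl ← ∈-map⁻ (rot u) x∈ = rot<N u a

  -- Circulant graphs with connection set `as`, used for even r and, with the antipode added, for
  -- odd r. That the offsets lie strictly between 0 and N excludes loops and makes the neighbours u
  -- + a distinct.
  module Cayley {E : List Edge} {as : List ℕ} (uas : Unique as) (0<as : ∀ {a : ℕ} → a ∈ as → 0 < a) (as<N : ∀ {a : ℕ} → a ∈ as → a < N)
                (linked : ∀ {u v : ℕ} → u < N → v < N → Linked E u v ⇔ v ∈ map (rot u) as) where

    loopless : ∀ v → v < N → (v , v) ∉ E
    loopless v v<N e with a , a∈ , eq ← ∈-map⁻ (rot v) (to (linked v<N v<N) (inj₁ e)) =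
      <⇒≢ (0<as a∈) (rot-injective v<N z<s (as<N a∈) (trans (rot-zero v<N) eq))

    degree : ∀ (u : Fin N) → deg (adjOf {N} E) u ≡ length as
    degree u = trans (deg-enumerated E u (unique-rot (toℕ<n u) as<N uas) (map-rot<N (toℕ u) as) (linked (toℕ<n u)))
                     (length-map (rot (toℕ u)) as)

  -- Antipodal matchings and the graphs with a hub.

  module Antipodal {h : ℕ} (N≡h+h : N ≡ h + h) where

    h<N : h < N
    h<N = subst (h <_) (sym N≡h+h) (m<m+n h (h>0 h N≡h+h))
      where
      h>0 : ∀ h → N ≡ h + h → 0 < h
      h>0 (suc h) _ = z<s

    h+i<N : ∀ {i} → i < h → h + i < N
    h+i<N {i} i<h = subst (h + i <_) (sym N≡h+h) (+-monoʳ-< h i<h)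

    rot-low : ∀ {i} → i < h → rot i h ≡ h + i
    rot-low {i} i<h = trans (cong (_% N) (+-comm i h)) (m<n⇒m%n≡m (h+i<N i<h))

    rot-high : ∀ {i} → i < h → rot (h + i) h ≡ i
    rot-high {i} i<h = begin
      (h + i + h) % N    ≡⟨ cong (λ z → (z + h) % N) (+-comm h i) ⟩
      (i + h + h) % N    ≡⟨ cong (_% N) (+-assoc i h h) ⟩
      (i + (h + h)) % N  ≡⟨ cong (λ z → (i + z) % N) N≡h+h ⟨
      (i + N) % N        ≡⟨ [m+n]%n≡m%n i N ⟩
      i % N              ≡⟨ m<n⇒m%n≡m (<-trans i<h h<N) ⟩
      i                  ∎
      where open ≡-Reasoning

    ends-full : ∀ {u} → u < N → u ∈ ends h h
    ends-full {u} u<N with u <? h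
    ... | yes u<h = ∈-++⁺ˡ (∈-upTo⁺ u<h)
    ... | no u≮h = subst (_∈ ends h h) (m+[n∸m]≡n h≤u) (∈-++⁺ʳ (upTo h) (∈-map⁺ (h +_) (∈-upTo⁺ u∸h<h)))
      where
      h≤u = ≮⇒≥ u≮h
      u∸h<h : u ∸ h < h
      u∸h<h = +-cancelˡ-< h _ _ (subst₂ _<_ (sym (m+[n∸m]≡n h≤u)) N≡h+h u<N)

    module _ {q : ℕ} (q≤h : q ≤ h) where

      ends<N : ∀ {u} → u ∈ ends h q → u < N
      ends<N u∈ with ∈-ends⁻ h q u∈
      ... | inj₁ u<q = <-trans (<-≤-trans u<q q≤h) h<N
      ... | inj₂ (i , i<q , refl) = h+i<N (<-≤-trans i<q q≤h)

      unique-ends : Unique (ends h q)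
      unique-ends = Unique.++⁺ (Unique.upTo⁺ q) (Unique.map⁺ (+-cancelˡ-≡ h _ _) (Unique.upTo⁺ q)) disjoint
        where
        disjoint : ∀ {a} → ¬ (a ∈ upTo q × a ∈ map (h +_) (upTo q))
        disjoint (p , p′) with j , _ , refl ← ∈-map⁻ (h +_) p′ = <⇒≱ (<-≤-trans (∈-upTo⁻ p) q≤h) (m≤m+n h j)

      -- Adding h modulo 2h exchanges i and h + i, so a rung looks the same from both of its ends.
      -- For q = h the matching thus amounts to the single offset h.
      linked-rungs : ∀ {u v} → Linked (rungs h q) u v ⇔ (v ≡ rot u h × u ∈ ends h q)
      linked-rungs = mk⇔ ⇒ ⇐
        where
        ⇒ : ∀ {u v} → Linked (rungs h q) u v → v ≡ rot u h × u ∈ ends h q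
        ⇒ (inj₁ e) with i , i<q , refl , refl ← to (∈-pairs id (h +_) q) e =
          sym (rot-low (<-≤-trans i<q q≤h)) , ∈-++⁺ˡ (∈-upTo⁺ i<q)
        ⇒ (inj₂ e) with i , i<q , refl , refl ← to (∈-pairs id (h +_) q) e =
          sym (rot-high (<-≤-trans i<q q≤h)) , ∈-++⁺ʳ (upTo q) (∈-map⁺ (h +_) (∈-upTo⁺ i<q))
        ⇐ : ∀ {u v} → v ≡ rot u h × u ∈ ends h q → Linked (rungs h q) u v
        ⇐ (refl , u∈) with ∈-ends⁻ h q u∈
        ... | inj₁ u<q = inj₁ (from (∈-pairs id (h +_) q) (_ , u<q , refl , rot-low (<-≤-trans u<q q≤h)))
        ... | inj₂ (i , i<q , refl) = inj₂ (from (∈-pairs id (h +_) q) (i , i<q , rot-high (<-≤-trans i<q q≤h) , refl))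

    module _ {k : ℕ} (k<h : k < h) where

      2k≤m : k + k ≤ m
      2k≤m = s≤s⁻¹ (subst (k + k <_) (sym N≡h+h) (+-mono-< k<h k<h))

      oddEdges : List Edge
      oddEdges = circEdges N (k * 2) ++ rungs h h

      oddOffsets : List ℕ
      oddOffsets = offsets k ++ [ h ]

      -- All offsets lie within circular distance k of 0, whereas the antipode is at distance h > k.
      h∉offsets : h ∉ offsets k
      h∉offsets h∈ with ∈-offsets⁻ k h∈
      ... | inj₁ (j , j<k , refl) = <⇒≱ k<h j<k
      ... | inj₂ (j , j<k , eq) = <-irrefl refl (begin-strict
        m          ≡⟨ m∸n+n≡m (≤-trans (<⇒≤ j<k) (k≤m 2k≤m)) ⟨
        m ∸ j + j  ≡⟨ cong (_+ j) eq ⟨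
        h + j      <⟨ s≤s (+-monoʳ-≤ h (≤-refl {j})) ⟩
        suc (h + j) ≡⟨ +-suc h j ⟨
        h + suc j  ≤⟨ +-monoʳ-≤ h j<k ⟩
        h + k      ≤⟨ s≤s⁻¹ (subst (h + k <_) (sym N≡h+h) (+-monoʳ-< h k<h)) ⟩
        m          ∎)
        where open ≤-Reasoning

      unique-oddOffsets : Unique oddOffsets
      unique-oddOffsets = Unique.++⁺ (unique-offsets {k} 2k≤m) ([] ∷ []) λ where (p , here refl) → h∉offsets p

      oddOffsets-positive : ∀ {a} → a ∈ oddOffsets → 0 < a
      oddOffsets-positive a∈ with ∈-++⁻ (offsets k) a∈
      ... | inj₁ p = offsets-positive {k} 2k≤m p
      ... | inj₂ (here refl) = ≤-<-trans z≤n k<h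

      oddOffsets<N : ∀ {a} → a ∈ oddOffsets → a < N
      oddOffsets<N a∈ with ∈-++⁻ (offsets k) a∈
      ... | inj₁ p = offsets<N {k} 2k≤m p
      ... | inj₂ (here refl) = h<N

      length-oddOffsets : length oddOffsets ≡ suc (k + k)
      length-oddOffsets = trans (length-++ (offsets k)) (trans (+-comm _ 1) (cong suc (length-offsets k)))

      linked-odd : ∀ {u v} → u < N → v < N → Linked oddEdges u v ⇔ v ∈ map (rot u) oddOffsets
      linked-odd {u} {v} u<N v<N = mk⇔ ⇒ ⇐
        where
        circ = linked-circ 2k≤m (k * 2) (⌊k*2/2⌋≡k k) u<N v<N
        rung = linked-rungs ≤-refl {u} {v}
        ⇒ : Linked oddEdges u v → v ∈ map (rot u) oddOffsets
        ⇒ l with linked-++⁻ (circEdges N (k * 2)) l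
        ... | inj₁ l′ = let a , a∈ , eq = ∈-map⁻ (rot u) (to circ l′) in
                        subst (_∈ _) (sym eq) (∈-map⁺ (rot u) (∈-++⁺ˡ a∈))
        ... | inj₂ l′ = subst (_∈ _) (sym (proj₁ (to rung l′))) (∈-map⁺ (rot u) (∈-++⁺ʳ (offsets k) (here refl)))
        ⇐ : v ∈ map (rot u) oddOffsets → Linked oddEdges u v
        ⇐ v∈ with a , a∈ , eq ← ∈-map⁻ (rot u) v∈ with ∈-++⁻ (offsets k) a∈
        ... | inj₁ p = Sum.map ∈-++⁺ˡ ∈-++⁺ˡ (from circ (subst (_∈ _) (sym eq) (∈-map⁺ (rot u) p)))
        ... | inj₂ (here refl) = Sum.map (∈-++⁺ʳ _) (∈-++⁺ʳ _) (from rung (eq , ends-full u<N))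

      -- Keeps the hub N out of the circulant part, so that its neighbours come from the spokes
      -- alone.
      oddEdges<N : ∀ {a b} → (a , b) ∈ oddEdges → a < N × b < N
      oddEdges<N {a} e with ∈-++⁻ (circEdges N (k * 2)) e
      ... | inj₁ e′ with a<N , j , _ , refl ← to (∈-circEdges m (k * 2)) e′ = a<N , rot<N a (suc j)
      ... | inj₂ e′ with i , i<h , refl , refl ← to (∈-pairs id (h +_) h) e′ = <-trans i<h h<N , h+i<N i<h

      module OddCirculant = Cayley {oddEdges} unique-oddOffsets oddOffsets-positive oddOffsets<N linked-odd

      module Hub {q : ℕ} (q≤h : q ≤ h) where

        hubEdges : List Edge
        hubEdges = withHub N h q oddEdges

        linked-rim : ∀ {u v} → u < N → v < N → Linked hubEdges u v ⇔ (Linked oddEdges u v × ¬ Linked (rungs h q) u v)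
        linked-rim {u} {v} u<N v<N = mk⇔ ⇒ ⇐
          where
          ⇒₁ : ∀ {a b} → b < N → (a , b) ∈ hubEdges → (a , b) ∈ oddEdges × ¬ Linked (rungs h q) a b
          ⇒₁ b<N e with to (∈-withHub N h q oddEdges) e
          ... | inj₁ p = p
          ... | inj₂ (refl , _) = ⊥-elim (<-irrefl refl b<N)
          ⇒ : Linked hubEdges u v → Linked oddEdges u v × ¬ Linked (rungs h q) u v
          ⇒ (inj₁ e) = let p , r = ⇒₁ v<N e in inj₁ p , r
          ⇒ (inj₂ e) = let p , r = ⇒₁ u<N e in inj₂ p , r ∘ Sum.swap
          ⇐ : Linked oddEdges u v × ¬ Linked (rungs h q) u v → Linked hubEdges u v
          ⇐ (inj₁ e , r) = inj₁ (from (∈-withHub N h q oddEdges) (inj₁ (e , r)))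
          ⇐ (inj₂ e , r) = inj₂ (from (∈-withHub N h q oddEdges) (inj₁ (e , r ∘ Sum.swap)))

        linked-hub : ∀ {v} → Linked hubEdges N v ⇔ v ∈ ends h q
        linked-hub {v} = mk⇔ ⇒ λ v∈ → inj₂ (from (∈-withHub N h q oddEdges) (inj₂ (refl , v∈)))
          where
          ⇒ : Linked hubEdges N v → v ∈ ends h q
          ⇒ (inj₁ e) with to (∈-withHub N h q oddEdges) e
          ... | inj₁ (e′ , _) = ⊥-elim (<-irrefl refl (proj₁ (oddEdges<N e′)))
          ... | inj₂ (_ , N∈) = ⊥-elim (<-irrefl refl (ends<N q≤h N∈))
          ⇒ (inj₂ e) with to (∈-withHub N h q oddEdges) e
          ... | inj₁ (e′ , _) = ⊥-elim (<-irrefl refl (proj₂ (oddEdges<N e′)))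
          ... | inj₂ (_ , v∈) = v∈

        -- Vertices with and without a deleted rung are treated alike: only the last entry depends
        -- on the case, the hub standing in for the antipode, so the length is the same.
        rimNeighbours : ℕ → List ℕ
        rimNeighbours u = map (rot u) (offsets k) ++ [ (if does (u ∈? ends h q) then N else rot u h) ]

        linked-rimNeighbours : ∀ {u v} → u < N → v < suc N → Linked hubEdges u v ⇔ v ∈ rimNeighbours u
        linked-rimNeighbours {u} {v} u<N v<sN with u ∈? ends h q
        ... | no u∉ = mk⇔ ⇒ ⇐
          where
          ≡map : map (rot u) oddOffsets ≡ map (rot u) (offsets k) ++ [ rot u h ]
          ≡map = map-++ (rot u) (offsets k) [ h ]
          ⇒ : Linked hubEdges u v → v ∈ map (rot u) (offsets k) ++ [ rot u h ]
          ⇒ l with m<1+n⇒m<n∨m≡n v<sN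
          ... | inj₁ v<N = subst (v ∈_) ≡map (to (linked-odd u<N v<N) (proj₁ (to (linked-rim u<N v<N) l)))
          ... | inj₂ refl = ⊥-elim (u∉ (to linked-hub (Sum.swap l)))
          ⇐ : v ∈ map (rot u) (offsets k) ++ [ rot u h ] → Linked hubEdges u v
          ⇐ v∈′ = from (linked-rim u<N v<N) (from (linked-odd u<N v<N) v∈ , u∉ ∘ proj₂ ∘ to (linked-rungs q≤h))
            where
            v∈ = subst (v ∈_) (sym ≡map) v∈′
            v<N = map-rot<N u oddOffsets v∈
        ... | yes u∈ = mk⇔ ⇒ ⇐
          where
          ⇒ : Linked hubEdges u v → v ∈ map (rot u) (offsets k) ++ [ N ]
          ⇒ l with m<1+n⇒m<n∨m≡n v<sN
          ... | inj₂ refl = ∈-++⁺ʳ (map (rot u) (offsets k)) (here refl)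
          ... | inj₁ v<N with l′ , ¬r ← to (linked-rim u<N v<N) l
                         with a , a∈ , eq ← ∈-map⁻ (rot u) (to (linked-odd u<N v<N) l′)
                         with ∈-++⁻ (offsets k) a∈
          ... | inj₁ a∈′ = ∈-++⁺ˡ (subst (_∈ map (rot u) (offsets k)) (sym eq) (∈-map⁺ (rot u) a∈′))
          ... | inj₂ (here refl) = ⊥-elim (¬r (from (linked-rungs q≤h) (eq , u∈)))
          ⇐ : v ∈ map (rot u) (offsets k) ++ [ N ] → Linked hubEdges u v
          ⇐ v∈ with ∈-++⁻ (map (rot u) (offsets k)) v∈
          ... | inj₂ (here refl) = Sum.swap (from linked-hub u∈)
          ... | inj₁ v∈′ with a , a∈ , refl ← ∈-map⁻ (rot u) v∈′ =
            -- A deleted rung would leave u with offset h, which is not in `offsets k`; so this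
            -- circulant edge survives.
            from (linked-rim u<N (rot<N u a)) (from (linked-odd u<N (rot<N u a)) (∈-map⁺ (rot u) (∈-++⁺ˡ a∈)) ,
              λ r → h∉offsets (subst (_∈ offsets k)
                (rot-injective u<N (offsets<N {k} 2k≤m a∈) h<N (proj₁ (to (linked-rungs q≤h) r))) a∈))

        rimNeighbours<N : ∀ u {v} → v ∈ rimNeighbours u → v < suc N
        rimNeighbours<N u v∈ with ∈-++⁻ (map (rot u) (offsets k)) v∈
        ... | inj₁ v∈′ = m<n⇒m<1+n (map-rot<N u (offsets k) v∈′)
        ... | inj₂ (here refl) with does (u ∈? ends h q)
        ...   | true = ≤-refl
        ...   | false = m<n⇒m<1+n (rot<N u h)

        unique-rimNeighbours : ∀ {u} → u < N → Unique (rimNeighbours u)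
        unique-rimNeighbours {u} u<N =
          Unique.++⁺ (unique-rot u<N (offsets<N {k} 2k≤m) (unique-offsets {k} 2k≤m)) ([] ∷ []) λ where (p , here refl) → last∉ p
          where
          last∉ : (if does (u ∈? ends h q) then N else rot u h) ∉ map (rot u) (offsets k)
          last∉ v∈ with does (u ∈? ends h q)
          ... | true = <-irrefl refl (map-rot<N u (offsets k) v∈)
          ... | false with a , a∈ , eq ← ∈-map⁻ (rot u) v∈ =
            h∉offsets (subst (_∈ offsets k) (sym (rot-injective u<N h<N (offsets<N {k} 2k≤m a∈) eq)) a∈)

        degree-rim : ∀ (u : Fin (suc N)) → toℕ u < N → deg (adjOf {suc N} hubEdges) u ≡ suc (k + k)
        degree-rim u u<N = begin
          deg (adjOf {suc N} hubEdges) u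
            ≡⟨ deg-enumerated hubEdges u (unique-rimNeighbours u<N) (rimNeighbours<N (toℕ u)) (linked-rimNeighbours u<N) ⟩
          length (rimNeighbours (toℕ u))                  ≡⟨ length-++ (map (rot (toℕ u)) (offsets k)) ⟩
          length (map (rot (toℕ u)) (offsets k)) + 1      ≡⟨ +-comm _ 1 ⟩
          suc (length (map (rot (toℕ u)) (offsets k)))    ≡⟨ cong suc (length-map (rot (toℕ u)) (offsets k)) ⟩
          suc (length (offsets k))                        ≡⟨ cong suc (length-offsets k) ⟩
          suc (k + k)                                     ∎
          where open ≡-Reasoning

        degree-hub : ∀ (u : Fin (suc N)) → toℕ u ≡ N → deg (adjOf {suc N} hubEdges) u ≡ q + q
        degree-hub u u≡N = trans
          (deg-enumerated hubEdges u (unique-ends q≤h) (m<n⇒m<1+n ∘ ends<N q≤h)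
            λ {v} _ → subst (λ w → Linked hubEdges w v ⇔ v ∈ ends h q) (sym u≡N) linked-hub)
          (length-ends h q)

        loopless : ∀ v → v < suc N → (v , v) ∉ hubEdges
        loopless v v<sN e with m<1+n⇒m<n∨m≡n v<sN
        ... | inj₁ v<N = [ OddCirculant.loopless v v<N , OddCirculant.loopless v v<N ]′ (proj₁ (to (linked-rim v<N v<N) (inj₁ e)))
        ... | inj₂ refl = <-irrefl refl (ends<N q≤h (to linked-hub (inj₁ e)))

-- Degree enumerators as sums

≡ᵇ-refl : ∀ a → (a ≡ᵇ a) ≡ true
≡ᵇ-refl zero    = refl
≡ᵇ-refl (suc a) = ≡ᵇ-refl a

≢⇒≡ᵇ-false : ∀ {a b} → a ≢ b → (a ≡ᵇ b) ≡ false
≢⇒≡ᵇ-false {zero}  {zero}  a≢b = contradiction refl a≢b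
≢⇒≡ᵇ-false {zero}  {suc b} a≢b = refl
≢⇒≡ᵇ-false {suc a} {zero}  a≢b = refl
≢⇒≡ᵇ-false {suc a} {suc b} a≢b = ≢⇒≡ᵇ-false (a≢b ∘ cong suc)

δ : ℕ → ℕ → ℕ
δ a b = if a ≡ᵇ b then 1 else 0

δ-refl : ∀ a → δ a a ≡ 1
δ-refl a rewrite ≡ᵇ-refl a = refl

δ-distinct : ∀ {a b} → a ≢ b → δ a b ≡ 0
δ-distinct a≢b rewrite ≢⇒≡ᵇ-false a≢b = refl

scaledUnit≡ : ∀ n c r (i : Fin n) → scaledUnit n c r i ≡ c * δ r (toℕ i)
scaledUnit≡ n c r i with r ≟ toℕ i
... | yes refl rewrite ≡ᵇ-refl (toℕ i) = sym (*-identityʳ c)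
... | no r≢i rewrite ≢⇒≡ᵇ-false r≢i | ≢⇒≡ᵇ-false (r≢i ∘ sym) = sym (*-zeroʳ c)

eR≡ : ∀ n r (i : Fin n) → eR n r i ≡ n * δ r (toℕ i)
eR≡ n r = scaledUnit≡ n n r

eRS≡ : ∀ N r s (i : Fin (suc N)) → eRS (suc N) r s i ≡ N * δ r (toℕ i) + δ s (toℕ i)
eRS≡ N r s i = cong₂ _+_ (scaledUnit≡ (suc N) N r i) (trans (scaledUnit≡ (suc N) 1 s i) (*-identityˡ _))

sum-const : ∀ n c → sum {n} (λ _ → c) ≡ n * c
sum-const zero    c = refl
sum-const (suc n) c = cong (c +_) (sum-const n c)

sum-δ : ∀ {n d} (c : ℕ → ℕ) → d < n → sum {n} (λ i → c (toℕ i) * δ d (toℕ i)) ≡ c d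
sum-δ {suc n} {zero} c _ = begin
  c 0 * 1 + sum {n} (λ i → c (suc (toℕ i)) * 0)   ≡⟨ cong₂ _+_ (*-identityʳ (c 0)) (sum-cong-≗ {n} (λ i → *-zeroʳ (c (suc (toℕ i))))) ⟩
  c 0 + sum {n} (λ _ → 0)                         ≡⟨ cong (c 0 +_) (sum-replicate-zero n) ⟩
  c 0 + 0                                         ≡⟨ +-identityʳ (c 0) ⟩
  c 0                                             ∎
  where open ≡-Reasoning
sum-δ {suc n} {suc d} c d<n = trans (cong (_+ sum {n} (λ i → c (suc (toℕ i)) * δ d (toℕ i))) (*-zeroʳ (c 0))) (sum-δ (c ∘ suc) (s≤s⁻¹ d<n))

term≤sum : ∀ {n} (f : Fin n → ℕ) v → f v ≤ sum f
term≤sum f Fin.zero    = m≤m+n _ _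
term≤sum f (Fin.suc v) = ≤-trans (term≤sum (f ∘ Fin.suc) v) (m≤n+m _ _)

∣-sum : ∀ {n d} (f : Fin n → ℕ) → (∀ v → d ∣ f v) → d ∣ sum f
∣-sum {zero}  f d∣f = _ ∣0
∣-sum {suc n} f d∣f = ∣m∣n⇒∣m+n (d∣f Fin.zero) (∣-sum (f ∘ Fin.suc) (d∣f ∘ Fin.suc))

count≡sum : ∀ {n} (p : Fin n → Bool) → count p ≡ sum (λ v → if p v then 1 else 0)
count≡sum {zero}  p = refl
count≡sum {suc n} p = cong ((if p Fin.zero then 1 else 0) +_) (count≡sum (p ∘ Fin.suc))

count≤n : ∀ {n} (p : Fin n → Bool) → count p ≤ n
count≤n {zero}  p = z≤n
count≤n {suc n} p with p Fin.zero
... | true  = s≤s (count≤n (p ∘ Fin.suc))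
... | false = m≤n⇒m≤1+n (count≤n (p ∘ Fin.suc))

count<n : ∀ {n} (p : Fin n → Bool) v → p v ≡ false → count p < n
count<n {suc n} p Fin.zero    eq rewrite eq = s≤s (count≤n (p ∘ Fin.suc))
count<n {suc n} p (Fin.suc v) eq with p Fin.zero
... | true  = s≤s (count<n (p ∘ Fin.suc) v eq)
... | false = m≤n⇒m≤1+n (count<n (p ∘ Fin.suc) v eq)

degree : ∀ {n} → SimpleGraph n → Fin n → ℕ
degree H = deg (adj H)

degree<n : ∀ {n} (H : SimpleGraph n) v → degree H v < n
degree<n H v = count<n (adj H v) v (irrefl H v)

degEnum≡ : ∀ {n} (A : Adj n) i → degEnum A i ≡ sum (λ v → δ (deg A v) (toℕ i))
degEnum≡ A i = count≡sum (λ v → deg A v ≡ᵇ toℕ i)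

-- The sums over degrees and over vertices are exchanged. No vertex is lost, because every degree is
-- below n and hence a coordinate.
weighted-enum : ∀ {n} (c : ℕ → ℕ) (H : SimpleGraph n) → sum (λ i → c (toℕ i) * enum H i) ≡ sum (λ v → c (degree H v))
weighted-enum {n} c H = begin
  sum (λ i → c (toℕ i) * enum H i)
    ≡⟨ sum-cong-≗ {n} (λ i → trans (cong (c (toℕ i) *_) (degEnum≡ (adj H) i)) (*-distribˡ-sum (c (toℕ i)) (λ v → δ (degree H v) (toℕ i)))) ⟩
  sum {n} (λ i → sum (λ v → c (toℕ i) * δ (degree H v) (toℕ i)))
    ≡⟨ ∑-comm {n} {n} (λ i v → c (toℕ i) * δ (degree H v) (toℕ i)) ⟩
  sum (λ v → sum {n} (λ i → c (toℕ i) * δ (degree H v) (toℕ i)))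
    ≡⟨ sum-cong-≗ (λ v → sum-δ c (degree<n H v)) ⟩
  sum (λ v → c (degree H v)) ∎
  where open ≡-Reasoning

degEnum-regular : ∀ {n r} (A : Adj n) → (∀ v → deg A v ≡ r) → degEnum A ≈ℕ eR n r
degEnum-regular {n} {r} A reg i = begin
  degEnum A i                        ≡⟨ degEnum≡ A i ⟩
  sum (λ v → δ (deg A v) (toℕ i))    ≡⟨ sum-cong-≗ (λ v → cong (λ d → δ d (toℕ i)) (reg v)) ⟩
  sum {n} (λ _ → δ r (toℕ i))        ≡⟨ sum-const n _ ⟩
  n * δ r (toℕ i)                    ≡⟨ eR≡ n r i ⟨
  eR n r i                           ∎
  where open ≡-Reasoning

degEnum-almostRegular : ∀ {N r s} (A : Adj (suc N)) u → deg A u ≡ s → (∀ j → deg A (punchIn u j) ≡ r) →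
                        degEnum A ≈ℕ eRS (suc N) r s
degEnum-almostRegular {N} {r} {s} A u hub rim i = begin
  degEnum A i                                             ≡⟨ degEnum≡ A i ⟩
  sum (λ v → δ (deg A v) (toℕ i))                         ≡⟨ sum-remove {i = u} (λ v → δ (deg A v) (toℕ i)) ⟩
  δ (deg A u) (toℕ i) + sum (λ j → δ (deg A (punchIn u j)) (toℕ i))
    ≡⟨ cong₂ _+_ (cong (λ d → δ d (toℕ i)) hub) (sum-cong-≗ (λ j → cong (λ d → δ d (toℕ i)) (rim j))) ⟩
  δ s (toℕ i) + sum {N} (λ _ → δ r (toℕ i))               ≡⟨ +-comm (δ s (toℕ i)) _ ⟩
  sum {N} (λ _ → δ r (toℕ i)) + δ s (toℕ i)               ≡⟨ cong (_+ δ s (toℕ i)) (sum-const N _) ⟩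
  N * δ r (toℕ i) + δ s (toℕ i)                           ≡⟨ eRS≡ N r s i ⟨
  eRS (suc N) r s i                                       ∎
  where open ≡-Reasoning

-- The handshake lemma.

2∣a+a : ∀ a → 2 ∣ a + a
2∣a+a a = divides a (trans (cong (a +_) (sym (+-identityʳ a))) (*-comm 2 a))

-- Row 0 and column 0 have the same sum S by symmetry, their common diagonal entry vanishes, and
-- what remains is a smaller matrix of the same kind.
∣-symmetricSum : ∀ {n} (a : Fin n → Fin n → ℕ) → (∀ v w → a v w ≡ a w v) → (∀ v → a v v ≡ 0) → 2 ∣ sum (λ v → sum (a v))
∣-symmetricSum {zero} a a-sym a-diag = 2 ∣0
∣-symmetricSum {suc n} a a-sym a-diag = subst (2 ∣_) (sym split) (∣m∣n⇒∣m+n (2∣a+a S) (∣-symmetricSum a′ (λ v w → a-sym _ _) (λ v → a-diag _)))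
  where
  open ≡-Reasoning
  a′ : Fin n → Fin n → ℕ
  a′ v w = a (Fin.suc v) (Fin.suc w)
  S = sum (λ w → a Fin.zero (Fin.suc w))
  split : sum (λ v → sum (a v)) ≡ S + S + sum (λ v → sum (a′ v))
  split = begin
    a Fin.zero Fin.zero + S + sum (λ v → a (Fin.suc v) Fin.zero + sum (a′ v))
      ≡⟨ cong₂ _+_ (cong (_+ S) (a-diag Fin.zero)) (∑-distrib-+ (λ v → a (Fin.suc v) Fin.zero) (λ v → sum (a′ v))) ⟩
    S + (sum (λ v → a (Fin.suc v) Fin.zero) + sum (λ v → sum (a′ v)))
      ≡⟨ cong (λ T → S + (T + sum (λ v → sum (a′ v)))) (sum-cong-≗ (λ v → a-sym (Fin.suc v) Fin.zero)) ⟩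
    S + (S + sum (λ v → sum (a′ v)))
      ≡⟨ +-assoc S S _ ⟨
    S + S + sum (λ v → sum (a′ v)) ∎

∣-degreeSum : ∀ {n} (H : SimpleGraph n) → 2 ∣ sum (degree H)
∣-degreeSum H = subst (2 ∣_) (sym (sum-cong-≗ (λ v → count≡sum (adj H v))))
  (∣-symmetricSum (λ v w → if adj H v w then 1 else 0)
    (λ v w → cong (λ b → if b then 1 else 0) (SimpleGraph.sym H v w))
    (λ v → cong (λ b → if b then 1 else 0) (irrefl H v)))

parity : ∀ n → (∃[ k ] n ≡ k * 2) ⊎ (∃[ k ] n ≡ suc (k * 2))
parity zero = inj₁ (0 , refl)
parity (suc n) with parity n
... | inj₁ (k , refl) = inj₂ (k , refl)
... | inj₂ (k , refl) = inj₁ (suc k , refl)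

odd-witness : ∀ {n} → 2 ∤ n → ∃[ k ] n ≡ suc (k * 2)
odd-witness {n} 2∤n with parity n
... | inj₁ (k , eq) = contradiction (divides k eq) 2∤n
... | inj₂ odd = odd

2∤1+k*2 : ∀ k → 2 ∤ suc (k * 2)
2∤1+k*2 k 2∣ with ∣m+n∣m⇒∣n (subst (2 ∣_) (+-comm 1 (k * 2)) 2∣) (n∣m*n k)
... | divides (suc q) ()

-- If all degrees were odd, the sum of all 1 + d_v would be even; but it is n plus the even degree
-- sum.
evenDegree : ∀ {n} → 2 ∤ n → (H : SimpleGraph n) → ∃[ u ] 2 ∣ degree H u
evenDegree {n} 2∤n H with any? (λ v → 2 ∣? degree H v)
... | yes found = found
... | no none = contradiction (∣m+n∣m⇒∣n (subst (2 ∣_) split (∣-sum (λ v → 1 + degree H v) 2∣1+degree)) (∣-degreeSum H)) 2∤n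
  where
  2∣1+degree : ∀ v → 2 ∣ 1 + degree H v
  2∣1+degree v = let k , eq = odd-witness (λ 2∣d → none (v , 2∣d)) in divides (suc k) (cong suc eq)
  split : sum (λ v → 1 + degree H v) ≡ sum (degree H) + n
  split = trans (∑-distrib-+ (λ _ → 1) (degree H)) (trans (+-comm _ (sum (degree H)))
    (cong (sum (degree H) +_) (trans (sum-const n 1) (*-identityʳ n))))

-- Degrees of G_n(r) and G_n(r,s).

k+k≡k*2 : ∀ k → k + k ≡ k * 2
k+k≡k*2 k = trans (cong (k +_) (sym (+-identityʳ k))) (*-comm 2 k)

edgesR-even : ∀ n k → edgesR n (k * 2) ≡ circEdges n (k * 2)
edgesR-even n k rewrite m*n%n≡0 k 2 {{_}} = refl

edgesR-odd : ∀ n {h} k → n ≡ h + h → edgesR n (suc (k * 2)) ≡ circEdges n (k * 2) ++ rungs h h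
edgesR-odd n {h} k refl rewrite [m+kn]%n≡m%n 1 k 2 {{_}} | sym (n≡⌊n+n/2⌋ h) = refl

edgesRS-odd : ∀ N {h} k q → N ≡ h + h → edgesRS (suc N) (suc (k * 2)) (q * 2) ≡ withHub N h q (circEdges N (k * 2) ++ rungs h h)
edgesRS-odd N {h} k q N≡h+h = trans (cong (withHub N ⌊ N /2⌋ ⌊ q * 2 /2⌋) (edgesR-odd N {h} k N≡h+h))
  (cong₂ (λ h q → withHub N h q E) (trans (cong ⌊_/2⌋ N≡h+h) (sym (n≡⌊n+n/2⌋ h))) (⌊k*2/2⌋≡k q))
  where E = circEdges N (k * 2) ++ rungs h h

-- `G n r` is a bare adjacency, while the hull is spanned by values of `SimpleGraph`. The equation
-- for `adj H` lets one witness serve both.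
RegularG : ℕ → ℕ → Set
RegularG n r = ∃[ H ] (adj H ≡ G n r × (∀ v → degree H v ≡ r))

-- Stated for a variable E, so that matching on the equation turns E into `edgesR n r` and the
-- adjacencies agree by `refl`.
regularG-fromEdges : ∀ {n r} E → edgesR n r ≡ E → (∀ v → v < n → (v , v) ∉ E) → (∀ v → deg (adjOf {n} E) v ≡ r) → RegularG n r
regularG-fromEdges _ refl irr reg = edgeGraph _ irr , refl , reg

regularG : ∀ n r → r < n → 2 ∣ r ⊎ 2 ∣ n → RegularG n r
regularG (suc m) r r<n par with parity r
... | inj₁ (k , refl) = regularG-fromEdges (circEdges (suc m) (k * 2)) (edgesR-even (suc m) k) C.loopless
    (λ v → trans (C.degree v) (trans (length-offsets k) (k+k≡k*2 k)))
  where
  open Rotation m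
  2k≤m : k + k ≤ m
  2k≤m = subst (_≤ m) (sym (k+k≡k*2 k)) (s≤s⁻¹ r<n)
  module C = Cayley (unique-offsets {k} 2k≤m) (offsets-positive {k} 2k≤m) (offsets<N {k} 2k≤m) (linked-circ {k} 2k≤m (k * 2) (⌊k*2/2⌋≡k k))
... | inj₂ (k , refl) with par
...   | inj₁ 2∣r = contradiction 2∣r (2∤1+k*2 k)
...   | inj₂ (divides h n≡h*2) = regularG-fromEdges (circEdges (suc m) (k * 2) ++ rungs h h) (edgesR-odd (suc m) k n≡h+h) C.loopless
    (λ v → trans (C.degree v) (trans (A.length-oddOffsets {k} k<h) (cong suc (k+k≡k*2 k))))
  where
  open Rotation m
  n≡h+h : suc m ≡ h + h
  n≡h+h = trans n≡h*2 (sym (k+k≡k*2 h))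
  module A = Antipodal {h} n≡h+h
  k<h : k < h
  k<h = *-cancelʳ-< 2 k h (<-trans ≤-refl (subst (suc (k * 2) <_) n≡h*2 r<n))
  module C = A.OddCirculant {k} k<h

AlmostRegularG : ℕ → ℕ → ℕ → Set
AlmostRegularG N r s = ∃[ H ] (adj H ≡ GRS (suc N) r s × degree H (fromℕ N) ≡ s × (∀ j → degree H (punchIn (fromℕ N) j) ≡ r))

almostRegularG : ∀ N {r s} → 2 ∣ N → 2 ∤ r → r < N → 2 ∣ s → s < suc N → AlmostRegularG N r s
almostRegularG (suc m) (divides h N≡h*2) 2∤r r<N (divides q refl) s<n with odd-witness 2∤r
... | k , refl = fromEdges _ (edgesRS-odd (suc m) k q N≡h+h) H.loopless
    (trans (H.degree-hub (fromℕ (suc m)) (toℕ-fromℕ (suc m))) (k+k≡k*2 q))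
    (λ j → trans (H.degree-rim (punchIn (fromℕ (suc m)) j) (rim<N j)) (cong suc (k+k≡k*2 k)))
  where
  open Rotation m
  N≡h+h : suc m ≡ h + h
  N≡h+h = trans N≡h*2 (sym (k+k≡k*2 h))
  k<h : k < h
  k<h = *-cancelʳ-< 2 k h (<-trans ≤-refl (subst (suc (k * 2) <_) N≡h*2 r<N))
  q≤h : q ≤ h
  q≤h = *-cancelʳ-≤ q h 2 (subst (q * 2 ≤_) N≡h*2 (s≤s⁻¹ s<n))
  module H = Antipodal.Hub {h} N≡h+h {k} k<h {q} q≤h
  rim<N : ∀ j → toℕ (punchIn (fromℕ (suc m)) j) < suc m
  rim<N j = ≤∧≢⇒< (s≤s⁻¹ (toℕ<n _)) λ eq → punchInᵢ≢i (fromℕ (suc m)) j (toℕ-injective (trans eq (sym (toℕ-fromℕ (suc m)))))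
  fromEdges : ∀ {r s} E → edgesRS (suc (suc m)) r s ≡ E → (∀ v → v < suc (suc m) → (v , v) ∉ E) →
              deg (adjOf {suc (suc m)} E) (fromℕ (suc m)) ≡ s → (∀ j → deg (adjOf {suc (suc m)} E) (punchIn (fromℕ (suc m)) j) ≡ r) →
              AlmostRegularG (suc m) r s
  fromEdges _ refl irr hub rim = edgeGraph _ irr , refl , hub , rim

-- Functionals exposing the listed points.

vertex-minimiser : ∀ {n} (c : ℕ → ℕ) b (x : Fin n → ℕ) →
                   (∀ H → b ≤ sum (λ v → c (degree H v))) →
                   (∀ H → sum (λ v → c (degree H v)) ≤ b → enum H ≈ℕ x) →
                   ∀ H → sum (λ v → c (degree H v)) ≤ b → IsVertex n (embed x)
vertex-minimiser c b x bound tight H H≤b = Minimiser.isVertex (c ∘ toℕ) b x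
  (λ H → subst (b ≤_) (sym (weighted-enum c H)) (bound H))
  (λ H → tight H ∘ subst (_≤ b) (weighted-enum c H))
  H (subst (_≤ b) (sym (weighted-enum c H)) H≤b)

vertex-eR : ∀ {n r} → RegularG n r → IsVertex n (embed (eR n r))
vertex-eR {n} {r} (H , _ , reg) = vertex-minimiser c 0 (eR n r) (λ _ → z≤n) tight H
  (≤-reflexive (trans (sum-cong-≗ (λ v → trans (cong c (reg v)) (cong (1 ∸_) (δ-refl r)))) (sum-replicate-zero n)))
  where
  c : ℕ → ℕ
  c d = 1 ∸ δ r d
  c≡0 : ∀ {d} → c d ≡ 0 → d ≡ r
  c≡0 {d} eq with r ≟ d
  ... | yes refl = refl
  ... | no r≢d rewrite δ-distinct r≢d with () ← eq
  tight : ∀ H → sum (λ v → c (degree H v)) ≤ 0 → enum H ≈ℕ eR n r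
  tight H le = degEnum-regular (adj H) λ v → c≡0 (n≤0⇒n≡0 (≤-trans (term≤sum (λ v → c (degree H v)) v) le))

module OddEvenCost (r s : ℕ) where

  -- With r odd, a vertex of even degree costs at least 1. A graph of total cost at most 1 spends
  -- all of it there: every other vertex costs 0 and so has degree r, and the price 2 leaves s as
  -- the only even degree that is affordable.
  cost : ℕ → ℕ
  cost d with d ≟ r | d ≟ s | 2 ∣? d
  ... | yes _ | _     | _     = 0
  ... | no _  | yes _ | _     = 1
  ... | no _  | no _  | yes _ = 2
  ... | no _  | no _  | no _  = 1

  cost≡0 : ∀ d → cost d ≡ 0 → d ≡ r
  cost≡0 d eq with d ≟ r | d ≟ s | 2 ∣? d
  ... | yes d≡r | _ | _ = d≡r
  ... | no _ | yes _ | _ with () ← eq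
  ... | no _ | no _ | yes _ with () ← eq
  ... | no _ | no _ | no _ with () ← eq

  cost-r : cost r ≡ 0
  cost-r with r ≟ r | r ≟ s | 2 ∣? r
  ... | yes _ | _ | _ = refl
  ... | no r≢r | _ | _ = contradiction refl r≢r

  cost-s : cost s ≤ 1
  cost-s with s ≟ r | s ≟ s | 2 ∣? s
  ... | yes _ | _ | _ = z≤n
  ... | no _ | yes _ | _ = ≤-refl
  ... | no _ | no s≢s | _ = contradiction refl s≢s

  cost-even : 2 ∤ r → ∀ {d} → 2 ∣ d → 1 ≤ cost d
  cost-even 2∤r {d} 2∣d = n≢0⇒n>0 λ eq → 2∤r (subst (2 ∣_) (cost≡0 d eq) 2∣d)

  cost-cheap-even : 2 ∤ r → ∀ {d} → 2 ∣ d → cost d ≤ 1 → d ≡ s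
  cost-cheap-even 2∤r {d} 2∣d le with d ≟ r | d ≟ s | 2 ∣? d
  ... | yes refl | _ | _ = contradiction 2∣d 2∤r
  ... | no _ | yes d≡s | _ = d≡s
  ... | no _ | no _ | yes _ with s≤s () ← le
  ... | no _ | no _ | no 2∤d = contradiction 2∣d 2∤d

vertex-eRS : ∀ {N r s} → 2 ∤ suc N → 2 ∤ r → AlmostRegularG N r s → IsVertex (suc N) (embed (eRS (suc N) r s))
vertex-eRS {N} {r} {s} 2∤n 2∤r (H , _ , hub , rim) = vertex-minimiser cost 1 (eRS (suc N) r s) bound tight H H≤1
  where
  open OddEvenCost r s
  costs : SimpleGraph (suc N) → Fin (suc N) → ℕ
  costs H v = cost (degree H v)
  bound : ∀ H → 1 ≤ sum (costs H)
  bound H = let u , 2∣d = evenDegree 2∤n H in ≤-trans (cost-even 2∤r 2∣d) (term≤sum (costs H) u)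
  tight : ∀ H → sum (costs H) ≤ 1 → enum H ≈ℕ eRS (suc N) r s
  tight H le with u , 2∣d ← evenDegree 2∤n H = degEnum-almostRegular (adj H) u
      (cost-cheap-even 2∤r 2∣d (≤-trans (term≤sum (costs H) u) le))
      (λ j → cost≡0 _ (n≤0⇒n≡0 (≤-trans (term≤sum (λ j → costs H (punchIn u j)) j) rest≤0)))
    where
    rest≤0 : sum (λ j → costs H (punchIn u j)) ≤ 0
    rest≤0 = s≤s⁻¹ (≤-trans (+-monoˡ-≤ _ (cost-even 2∤r 2∣d)) (subst (_≤ 1) (sum-remove {i = u} (costs H)) le))
  H≤1 : sum (costs H) ≤ 1
  H≤1 = begin
    sum (costs H)                                                         ≡⟨ sum-remove {i = fromℕ N} (costs H) ⟩
    costs H (fromℕ N) + sum (λ j → costs H (punchIn (fromℕ N) j))         ≡⟨ cong₂ _+_ (cong cost hub) (sum-cong-≗ (λ j → trans (cong cost (rim j)) cost-r)) ⟩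
    cost s + sum {N} (λ _ → 0)                                            ≡⟨ cong (cost s +_) (sum-replicate-zero N) ⟩
    cost s + 0                                                            ≡⟨ +-identityʳ _ ⟩
    cost s                                                                ≤⟨ cost-s ⟩
    1                                                                     ∎
    where open ≤-Reasoning

-- Extreme points belong to the list.

≈-trans-embed : ∀ {n} {x : Point n} {e e′} → x ≈ embed e → e ≈ℕ e′ → x ≈ embed e′
≈-trans-embed x≈e e≈e′ i = trans (x≈e i) (cong toℚ (e≈e′ i))

IsVertex-resp-≈ : ∀ {n} {x y : Point n} → x ≈ y → IsVertex n y → IsVertex n x
IsVertex-resp-≈ x≈y ((L , nn , sum≡1 , y≈) , extreme) =
  (L , nn , sum≡1 , λ i → trans (x≈y i) (y≈ i)) ,
  λ y z t y∈ z∈ 0<t t<1 x≡ → extreme y z t y∈ z∈ 0<t t<1 (λ i → trans (sym (x≈y i)) (x≡ i))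

degEnum-regularG : ∀ {n r} → RegularG n r → degEnum (G n r) ≈ℕ eR n r
degEnum-regularG {n} {r} (H , refl , reg) = degEnum-regular (adj H) reg

degEnum-almostRegularG : ∀ {N r s} → AlmostRegularG N r s → degEnum (GRS (suc N) r s) ≈ℕ eRS (suc N) r s
degEnum-almostRegularG {N} (H , refl , hub , rim) = degEnum-almostRegular (adj H) (fromℕ N) hub rim

enum-regularG : ∀ {n r} (R : RegularG n r) → enum (proj₁ R) ≈ℕ eR n r
enum-regularG (H , _ , reg) = degEnum-regular (adj H) reg

enum-almostRegularG : ∀ {N r s} (R : AlmostRegularG N r s) → enum (proj₁ R) ≈ℕ eRS (suc N) r s
enum-almostRegularG {N} (H , _ , hub , rim) = degEnum-almostRegular (adj H) (fromℕ N) hub rim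

vertexGraph⇒eR : ∀ {n} → 1 ≤ n → 2 ∣ n → ∀ {x} H → IsVertex n x → x ≈ embed (enum H) → ∃[ r ] (r < n × x ≈ embed (eR n r))
vertexGraph⇒eR {n@(suc m)} _ 2∣n {x} H vx x≈H =
  degree H Fin.zero , degree<n H Fin.zero ,
  ≈-trans-embed {e = enum (proj₁ (R Fin.zero))} (vertex≈block {x = x} {enum H} B 1 vx x≈H (λ _ → refl) average) (enum-regularG (R Fin.zero))
  where
  R : ∀ v → RegularG n (degree H v)
  R v = regularG n (degree H v) (degree<n H v) (inj₂ 2∣n)
  B : Fin n → Block {n}
  -- One copy each, stored as 0: n e(H) is the sum of n 1_d over the degrees d of the vertices of H.
  B v = (0 , proj₁ (R v)) , []
  average : ∀ i → n * 1 * enum H i ≡ sum (λ v → enumSum (graphs (B v)) i)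
  average i = begin
    n * 1 * enum H i                                  ≡⟨ cong₂ _*_ (*-identityʳ n) (degEnum≡ (adj H) i) ⟩
    n * sum (λ v → δ (degree H v) (toℕ i))            ≡⟨ *-distribˡ-sum n (λ v → δ (degree H v) (toℕ i)) ⟩
    sum (λ v → n * δ (degree H v) (toℕ i))            ≡⟨ sum-cong-≗ {n} (λ v → sym (trans (enum-regularG (R v) i) (eR≡ n (degree H v) i))) ⟩
    sum (λ v → enum (proj₁ (R v)) i)                  ≡⟨ sum-cong-≗ {n} (λ v → sym (trans (+-identityʳ (1 * enum (proj₁ (R v)) i)) (*-identityˡ (enum (proj₁ (R v)) i)))) ⟩
    sum (λ v → enumSum (graphs (B v)) i)              ∎
    where open ≡-Reasoning

vertex⇒eR : ∀ {n} → 1 ≤ n → 2 ∣ n → ∀ {x} → IsVertex n x → ∃[ r ] (r < n × x ≈ embed (eR n r))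
vertex⇒eR 1≤n 2∣n {x} vx = let H , x≈H = vertex≈graph {x = x} vx in vertexGraph⇒eR 1≤n 2∣n {x} H vx x≈H

OddVertex : (n : ℕ) → Point n → Set
OddVertex n x = (∃[ r ] (2 ∣ r × r < n × x ≈ embed (eR n r)))
              ⊎ (∃[ r ] ∃[ s ] (¬ (2 ∣ r) × 0 < r × r < n ∸ 1 × 2 ∣ s × s < n × x ≈ embed (eRS n r s)))

2∣pred : ∀ {N} → 2 ∤ suc N → 2 ∣ N
2∣pred 2∤n with k , refl ← odd-witness 2∤n = n∣m*n k

odd<N : ∀ {N r} → 2 ∣ N → 2 ∤ r → r < suc N → r < N
odd<N 2∣N 2∤r r<n = ≤∧≢⇒< (s≤s⁻¹ r<n) λ where refl → 2∤r 2∣N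

module _ {N r s : ℕ} (2∤n : 2 ∤ suc N) (r<n : r < suc N) (2∣s : 2 ∣ s) (s<n : s < suc N) where

  -- A block of n = N + 1 graphs averaging to N 1_r + 1_s. For odd r these are n copies of one
  -- graph, to match the size needed for even r. For even r the single s-regular graph comes first,
  -- since its multiplicity is positive even for N = 0.
  pointBlock : Dec (2 ∣ r) → Block {suc N}
  pointBlock (yes 2∣r) = (0 , proj₁ (regularG (suc N) s s<n (inj₁ 2∣s))) , (N , proj₁ (regularG (suc N) r r<n (inj₁ 2∣r))) ∷ []
  pointBlock (no 2∤r)  = (N , proj₁ (almostRegularG N (2∣pred 2∤n) 2∤r (odd<N (2∣pred 2∤n) 2∤r r<n) 2∣s s<n)) , []

  multiplicity-pointBlock : ∀ d → multiplicity (graphs (pointBlock d)) ≡ suc N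
  multiplicity-pointBlock (yes _) = cong suc (+-identityʳ N)
  multiplicity-pointBlock (no _)  = cong suc (+-identityʳ N)

  enumSum-pointBlock : ∀ d i → enumSum (graphs (pointBlock d)) i ≡ suc N * (N * δ r (toℕ i) + δ s (toℕ i))
  enumSum-pointBlock (yes 2∣r) i = begin
    1 * enum (proj₁ S) i + (N * enum (proj₁ R) i + 0)
      ≡⟨ cong₂ (λ a b → 1 * a + (N * b + 0)) (trans (enum-regularG S i) (eR≡ (suc N) s i)) (trans (enum-regularG R i) (eR≡ (suc N) r i)) ⟩
    1 * (suc N * δ s (toℕ i)) + (N * (suc N * δ r (toℕ i)) + 0)
      ≡⟨ solve 3 (λ N a b → con 1 :* ((con 1 :+ N) :* b) :+ (N :* ((con 1 :+ N) :* a) :+ con 0) := (con 1 :+ N) :* (N :* a :+ b)) refl N (δ r (toℕ i)) (δ s (toℕ i)) ⟩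
    suc N * (N * δ r (toℕ i) + δ s (toℕ i)) ∎
    where
    open ≡-Reasoning
    S = regularG (suc N) s s<n (inj₁ 2∣s)
    R = regularG (suc N) r r<n (inj₁ 2∣r)
  enumSum-pointBlock (no 2∤r) i = trans (+-identityʳ (suc N * enum (proj₁ R) i)) (cong (suc N *_) (trans (enum-almostRegularG R i) (eRS≡ N r s i)))
    where R = almostRegularG N (2∣pred 2∤n) 2∤r (odd<N (2∣pred 2∤n) 2∤r r<n) 2∣s s<n

  oddVertex : ∀ d {x} → x ≈ embed (enum (proj₂ (proj₁ (pointBlock d)))) → OddVertex (suc N) x
  oddVertex (yes 2∣r) x≈ = inj₁ (s , 2∣s , s<n , ≈-trans-embed {e = enum (proj₁ (regularG (suc N) s s<n (inj₁ 2∣s)))} x≈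
    (enum-regularG (regularG (suc N) s s<n (inj₁ 2∣s))))
  oddVertex (no 2∤r) x≈ = inj₂ (r , s , 2∤r , n≢0⇒n>0 (λ where refl → 2∤r (divides 0 refl)) , r<N , 2∣s , s<n ,
    ≈-trans-embed {e = enum (proj₁ R)} x≈ (enum-almostRegularG R))
    where
    r<N = odd<N (2∣pred 2∤n) 2∤r r<n
    R = almostRegularG N (2∣pred 2∤n) 2∤r r<N 2∣s s<n

vertexGraph⇒oddVertex : ∀ {n} → 1 ≤ n → 2 ∤ n → ∀ {x} H u → 2 ∣ degree H u → IsVertex n x → x ≈ embed (enum H) → OddVertex n x
-- For n = 1 there is no vertex besides u to average over; the only degree is 0.
vertexGraph⇒oddVertex {suc zero} _ 2∤n {x} H _ _ vx x≈H =
  inj₁ (0 , divides 0 refl , z<s , ≈-trans-embed {e = enum H} x≈H (degEnum-regular (adj H) (λ v → n<1⇒n≡0 (degree<n H v))))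
vertexGraph⇒oddVertex {n@(suc N@(suc N-1))} _ 2∤n {x} H u 2∣s vx x≈H =
  oddVertex 2∤n (r<n Fin.zero) 2∣s s<n (2 ∣? r Fin.zero) (vertex≈block {x = x} {enum H} B n vx x≈H B≡n average)
  where
  s = degree H u
  s<n = degree<n H u
  r : Fin N → ℕ
  r j = degree H (punchIn u j)
  r<n : ∀ j → r j < n
  r<n j = degree<n H (punchIn u j)
  B : Fin N → Block {n}
  B j = pointBlock 2∤n (r<n j) 2∣s s<n (2 ∣? r j)
  B≡n : ∀ j → multiplicity (graphs (B j)) ≡ n
  B≡n j = multiplicity-pointBlock 2∤n (r<n j) 2∣s s<n (2 ∣? r j)
  average : ∀ i → N * n * enum H i ≡ sum (λ j → enumSum (graphs (B j)) i)
  -- e(H) is 1_s plus the indicators of the N other degrees. Multiplied by N, it hands one copy of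
  -- 1_s to each of the N blocks; the factor n is the block size.
  average i = begin
    N * n * enum H i                                                ≡⟨ cong (N * n *_) (trans (degEnum≡ (adj H) i) (sum-remove {i = u} (λ v → δ (degree H v) (toℕ i)))) ⟩
    N * n * (δs + sum δr)                                           ≡⟨ solve 4 (λ N n a b → N :* n :* (a :+ b) := n :* (N :* b :+ N :* a)) refl N n δs (sum δr) ⟩
    n * (N * sum δr + N * δs)                                       ≡⟨ cong (n *_) (cong₂ _+_ (*-distribˡ-sum N δr) (sym (sum-const N δs))) ⟩
    n * (sum (λ j → N * δr j) + sum {N} (λ _ → δs))                 ≡⟨ cong (n *_) (∑-distrib-+ (λ j → N * δr j) (λ _ → δs)) ⟨
    n * sum (λ j → N * δr j + δs)                                   ≡⟨ *-distribˡ-sum n (λ j → N * δr j + δs) ⟩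
    sum (λ j → n * (N * δr j + δs))                                 ≡⟨ sum-cong-≗ {N} (λ j → sym (enumSum-pointBlock 2∤n (r<n j) 2∣s s<n (2 ∣? r j) i)) ⟩
    sum (λ j → enumSum (graphs (B j)) i)                            ∎
    where
    open ≡-Reasoning
    δs = δ s (toℕ i)
    δr : Fin N → ℕ
    δr j = δ (r j) (toℕ i)

vertex⇒oddVertex : ∀ {n} → 1 ≤ n → 2 ∤ n → ∀ {x} → IsVertex n x → OddVertex n x
vertex⇒oddVertex 1≤n 2∤n {x} vx =
  let H , x≈H = vertex≈graph {x = x} vx
      u , 2∣s = evenDegree 2∤n H
  in vertexGraph⇒oddVertex 1≤n 2∤n {x} H u 2∣s vx x≈H

-- Counting the vertices

at : ∀ {n} {e e′ : Fin n → ℕ} {k} → k < n → (f f′ : ℕ → ℕ) → (∀ i → e i ≡ f (toℕ i)) → (∀ i → e′ i ≡ f′ (toℕ i)) → e ≈ℕ e′ → f k ≡ f′ k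
at k<n f f′ e≡ e′≡ e≈e′ = subst (λ k → f k ≡ f′ k) (toℕ-fromℕ< k<n)
  (trans (sym (e≡ (fromℕ< k<n))) (trans (e≈e′ (fromℕ< k<n)) (e′≡ (fromℕ< k<n))))

scaled-δ-injective : ∀ {c a b} → 0 < c → c * δ a a ≡ c * δ b a → a ≡ b
scaled-δ-injective {c} {a} {b} 0<c eq with b ≟ a
... | yes refl = refl
... | no b≢a = contradiction (trans (trans (sym (*-identityʳ c)) (cong (c *_) (sym (δ-refl a)))) (trans eq (trans (cong (c *_) (δ-distinct b≢a)) (*-zeroʳ c))))
                 (n>0⇒n≢0 0<c)

eR-injective : ∀ {n r r′} → r < n → eR n r ≈ℕ eR n r′ → r ≡ r′
eR-injective {n} {r} {r′} r<n eq = scaled-δ-injective (≤-<-trans z≤n r<n)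
  (at r<n (λ k → n * δ r k) (λ k → n * δ r′ k) (eR≡ n r) (eR≡ n r′) eq)

module _ {N : ℕ} where

  private
    n = suc N

  -- Coordinate r′ separates the points: it is 0 on the left and N > 0 on the right.
  eR≉eRS : ∀ {r r′ s′} → r ≢ r′ → r′ < n → s′ ≢ r′ → 0 < N → ¬ (eR n r ≈ℕ eRS n r′ s′)
  eR≉eRS {r} {r′} {s′} r≢r′ r′<n s′≢r′ 0<N eq = n>0⇒n≢0 0<N (begin
    N                               ≡⟨ trans (+-identityʳ (N * 1)) (*-identityʳ N) ⟨
    N * 1 + 0                       ≡⟨ cong₂ (λ a b → N * a + b) (δ-refl r′) (δ-distinct s′≢r′) ⟨
    N * δ r′ r′ + δ s′ r′           ≡⟨ at r′<n (λ k → n * δ r k) (λ k → N * δ r′ k + δ s′ k) (eR≡ n r) (eRS≡ N r′ s′) eq ⟨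
    n * δ r r′                      ≡⟨ cong (n *_) (δ-distinct r≢r′) ⟩
    n * 0                           ≡⟨ *-zeroʳ n ⟩
    0                               ∎)
    where open ≡-Reasoning

  -- Coordinate r determines r, since neither s nor s′ contributes to it, and coordinate s then
  -- determines s. In the application all the inequalities come from parity.
  eRS-injective : ∀ {r s r′ s′} → 0 < N → r < n → s < n → s ≢ r → s ≢ r′ → s′ ≢ r →
                  eRS n r s ≈ℕ eRS n r′ s′ → r ≡ r′ × s ≡ s′
  eRS-injective {r} {s} {r′} {s′} 0<N r<n s<n s≢r s≢r′ s′≢r eq =
    scaled-δ-injective 0<N (trans (trans (sym (+-identityʳ _)) (cong (N * δ r r +_) (sym (δ-distinct s≢r))))
      (trans (coordinate r<n) (trans (cong (N * δ r′ r +_) (δ-distinct s′≢r)) (+-identityʳ _)))) ,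
    scaled-δ-injective {1} z<s (trans (*-identityˡ _) (trans
      (trans (sym (off (s≢r ∘ sym) s)) (trans (coordinate s<n) (off (s≢r′ ∘ sym) s′))) (sym (*-identityˡ _))))
    where
    coordinate : ∀ {k} → k < n → N * δ r k + δ s k ≡ N * δ r′ k + δ s′ k
    coordinate k<n = at k<n (λ k → N * δ r k + δ s k) (λ k → N * δ r′ k + δ s′ k) (eRS≡ N r s) (eRS≡ N r′ s′) eq
    off : ∀ {a} → a ≢ s → ∀ b → N * δ a s + δ b s ≡ δ b s
    off {a} a≢s b = cong (_+ δ b s) (trans (cong (N *_) (δ-distinct a≢s)) (*-zeroʳ N))

vertexCount-even : ∀ {n} → 1 ≤ n → 2 ∣ n → HasVertexCount n n
vertexCount-even {n} 1≤n 2∣n = (λ k → embed (eR n (toℕ k))) ,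
  (λ k → vertex-eR (regularG n (toℕ k) (toℕ<n k) (inj₂ 2∣n))) ,
  (λ k l eq → toℕ-injective (eR-injective (toℕ<n k) (embed-injective eq))) ,
  λ x vx → let r , r<n , x≈ = vertex⇒eR 1≤n 2∣n vx in
    fromℕ< r<n , λ i → trans (cong (λ r → embed (eR n r) i) (toℕ-fromℕ< r<n)) (sym (x≈ i))

module OddCount (h : ℕ) where

  private
    N = h * 2
    n = suc N

  2∤n : 2 ∤ n
  2∤n = 2∤1+k*2 h

  -- The square in the count is a grid: column b stands for the even number 2b, row 0 holds the h +
  -- 1 points n 1_{2b}, and row a + 1 holds the points with r = 2a + 1 and s = 2b.
  vertex : Fin (suc h) × Fin (suc h) → Point n
  vertex (Fin.zero  , b) = embed (eR n (toℕ b * 2))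
  vertex (Fin.suc a , b) = embed (eRS n (suc (toℕ a * 2)) (toℕ b * 2))

  even<n : ∀ (b : Fin (suc h)) → toℕ b * 2 < n
  even<n b = s≤s (*-monoˡ-≤ 2 (s≤s⁻¹ (toℕ<n b)))

  odd<N′ : ∀ (a : Fin h) → suc (toℕ a * 2) < N
  odd<N′ a = *-monoˡ-≤ 2 (toℕ<n a)

  half-injective : ∀ {k} {a b : Fin k} → toℕ a * 2 ≡ toℕ b * 2 → a ≡ b
  half-injective {a = a} {b} eq = toℕ-injective (*-cancelʳ-≡ (toℕ a) (toℕ b) 2 eq)

  double≢odd : ∀ k l → k * 2 ≢ suc (l * 2)
  double≢odd k l eq = 2∤1+k*2 l (divides k (sym eq))

  isVertex : ∀ p → IsVertex n (vertex p)
  isVertex (Fin.zero , b) = vertex-eR (regularG n (toℕ b * 2) (even<n b) (inj₁ (n∣m*n (toℕ b))))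
  isVertex (Fin.suc a , b) = vertex-eRS 2∤n (2∤1+k*2 (toℕ a))
    (almostRegularG N (n∣m*n h) (2∤1+k*2 (toℕ a)) (odd<N′ a) (n∣m*n (toℕ b)) (even<n b))

  vertex-injective : ∀ p q → vertex p ≈ vertex q → p ≡ q
  vertex-injective (Fin.zero , b) (Fin.zero , b′) eq = cong (Fin.zero ,_) (half-injective (eR-injective (even<n b) (embed-injective eq)))
  vertex-injective (Fin.zero , b) (Fin.suc a′ , b′) eq = contradiction (embed-injective eq)
    (eR≉eRS (double≢odd (toℕ b) (toℕ a′)) (m<n⇒m<1+n (odd<N′ a′)) (double≢odd (toℕ b′) (toℕ a′)) (≤-<-trans z≤n (odd<N′ a′)))
  vertex-injective (Fin.suc a , b) (Fin.zero , b′) eq = contradiction (sym ∘ embed-injective eq)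
    (eR≉eRS (double≢odd (toℕ b′) (toℕ a)) (m<n⇒m<1+n (odd<N′ a)) (double≢odd (toℕ b) (toℕ a)) (≤-<-trans z≤n (odd<N′ a)))
  vertex-injective (Fin.suc a , b) (Fin.suc a′ , b′) eq = cong₂ (λ a b → Fin.suc a , b) (half-injective (suc-injective (proj₁ both))) (half-injective (proj₂ both))
    where
    both = eRS-injective (≤-<-trans z≤n (odd<N′ a)) (m<n⇒m<1+n (odd<N′ a)) (even<n b)
      (double≢odd (toℕ b) (toℕ a)) (double≢odd (toℕ b) (toℕ a′)) (double≢odd (toℕ b′) (toℕ a)) (embed-injective eq)

  evenIndex : ∀ {s} → 2 ∣ s → s < n → ∃[ b ] s ≡ toℕ {suc h} b * 2
  evenIndex (divides q refl) s<n = fromℕ< q<1+h , cong (_* 2) (sym (toℕ-fromℕ< q<1+h))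
    where q<1+h = s≤s (*-cancelʳ-≤ q h 2 (s≤s⁻¹ s<n))

  oddIndex : ∀ {r} → 2 ∤ r → r < N → ∃[ a ] r ≡ suc (toℕ {h} a * 2)
  oddIndex 2∤r r<N with k , refl ← odd-witness 2∤r = fromℕ< k<h , cong (λ k → suc (k * 2)) (sym (toℕ-fromℕ< k<h))
    where k<h = *-cancelʳ-< 2 k h (<-trans (n<1+n _) r<N)

  vertex-surjective : ∀ {x} → OddVertex n x → ∃[ p ] (vertex p ≈ x)
  vertex-surjective {x} (inj₁ (r , 2∣r , r<n , x≈)) = let b , r≡ = evenIndex 2∣r r<n in
    (Fin.zero , b) , λ i → trans (cong (λ r → embed (eR n r) i) (sym r≡)) (sym (x≈ i))
  vertex-surjective {x} (inj₂ (r , s , 2∤r , _ , r<N , 2∣s , s<n , x≈)) =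
    let a , r≡ = oddIndex 2∤r r<N
        b , s≡ = evenIndex 2∣s s<n
    in (Fin.suc a , b) , λ i → trans (cong₂ (λ r s → embed (eRS n r s) i) (sym r≡) (sym s≡)) (sym (x≈ i))

  vertexCount : HasVertexCount n (suc h * suc h)
  vertexCount = vertex ∘ remQuot {suc h} (suc h) , isVertex ∘ remQuot {suc h} (suc h) , injective , surjective
    where
    injective : ∀ k l → vertex (remQuot {suc h} (suc h) k) ≈ vertex (remQuot {suc h} (suc h) l) → k ≡ l
    injective k l eq = trans (sym (combine-remQuot {suc h} (suc h) k))
      (trans (cong (uncurry combine) (vertex-injective (remQuot {suc h} (suc h) k) (remQuot {suc h} (suc h) l) eq)) (combine-remQuot {suc h} (suc h) l))
    surjective : ∀ x → IsVertex n x → ∃[ k ] (vertex (remQuot {suc h} (suc h) k) ≈ x)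
    surjective x vx =
      let (a , b) , eq = vertex-surjective (vertex⇒oddVertex (s≤s z≤n) 2∤n {x} vx) in combine a b , λ i → trans (cong (λ p → vertex p i) (remQuot-combine {suc h} {suc h} a b)) (eq i)

vertexCount-odd : ∀ {n} → 2 ∤ n → HasVertexCount n (⌊ (n + 1) /2⌋ ^ 2)
vertexCount-odd 2∤n = fromHalf (odd-witness 2∤n)
  where
  half : ∀ h → ⌊ (suc (h * 2) + 1) /2⌋ ≡ suc h
  half h = trans (cong ⌊_/2⌋ (+-comm (suc (h * 2)) 1)) (cong suc (⌊k*2/2⌋≡k h))
  fromHalf : ∀ {n} → ∃[ h ] n ≡ suc (h * 2) → HasVertexCount n (⌊ (n + 1) /2⌋ ^ 2)
  -- The power `^ 2` unfolds to a product ending in a factor 1, which `*-identityʳ` removes.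
  fromHalf (h , refl) = subst (HasVertexCount (suc (h * 2)))
    (sym (cong₂ _*_ (half h) (trans (*-identityʳ ⌊ (suc (h * 2) + 1) /2⌋) (half h)))) (OddCount.vertexCount h)

oddVertex⇒vertex : ∀ {N x} → 2 ∤ suc N → OddVertex (suc N) x → IsVertex (suc N) x
oddVertex⇒vertex {N} {x} 2∤n (inj₁ (r , 2∣r , r<n , x≈)) =
  IsVertex-resp-≈ {x = x} {embed (eR (suc N) r)} x≈ (vertex-eR (regularG (suc N) r r<n (inj₁ 2∣r)))
oddVertex⇒vertex {N} {x} 2∤n (inj₂ (r , s , 2∤r , _ , r<N , 2∣s , s<n , x≈)) =
  IsVertex-resp-≈ {x = x} {embed (eRS (suc N) r s)} x≈ (vertex-eRS 2∤n 2∤r (almostRegularG N (2∣pred 2∤n) 2∤r r<N 2∣s s<n))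

theorem2p1 : (n : ℕ) → 1 ≤ n →
    ((2 ∣ n) →
    (∀ (x : Point n) → IsVertex n x ⇔ (∃[ r ] (r < n × x ≈ embed (eR n r))))
    × (∀ r → r < n → degEnum (G n r) ≈ℕ eR n r)
    × HasVertexCount n n)
    × (¬ (2 ∣ n) →
    (∀ (x : Point n) → IsVertex n x ⇔
    ((∃[ r ] (2 ∣ r × r < n × x ≈ embed (eR n r)))
    ⊎ (∃[ r ] ∃[ s ] (¬ (2 ∣ r) × 0 < r × r < n ∸ 1 × 2 ∣ s × s < n × x ≈ embed (eRS n r s)))))
    × (∀ r → 2 ∣ r → r < n → degEnum (G n r) ≈ℕ eR n r)
    × (∀ r s → ¬ (2 ∣ r) → 0 < r → r < n ∸ 1 → 2 ∣ s → s < n → degEnum (GRS n r s) ≈ℕ eRS n r s)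
    × HasVertexCount n (⌊ (n + 1) /2⌋ ^ 2))
theorem2p1 n@(suc N) 1≤n =
  (λ 2∣n →
    (λ x → mk⇔ (vertex⇒eR 1≤n 2∣n {x})
      λ (r , r<n , x≈) → IsVertex-resp-≈ {x = x} {embed (eR n r)} x≈ (vertex-eR (regularG n r r<n (inj₂ 2∣n)))) ,
    (λ r r<n → degEnum-regularG (regularG n r r<n (inj₂ 2∣n))) ,
    vertexCount-even 1≤n 2∣n) ,
  λ 2∤n →
    (λ x → mk⇔ (vertex⇒oddVertex 1≤n 2∤n {x}) (oddVertex⇒vertex {x = x} 2∤n)) ,
    (λ r 2∣r r<n → degEnum-regularG (regularG n r r<n (inj₁ 2∣r))) ,
    (λ r s 2∤r _ r<N 2∣s s<n → degEnum-almostRegularG (almostRegularG N (2∣pred 2∤n) 2∤r r<N 2∣s s<n)) ,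
    vertexCount-odd 2∤n
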